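{- For every integer $n\ge 0$, $$c\phi_7(7n+3)\equiv c\phi_7(7n+5)\equiv c\phi_7(7n+6)\equiv 0\pmod{7^3}.$$
   Context: A $k$-colored generalized Frobenius symbol is a two-row array with $d\ge 0$ columns whose entries are colored nonnegative integers $\ell_c$ ($\ell\ge 0$, color $c\in\{1,\dots,k\}$), each row strictly decreasing with respect to the total order $0_1\prec 0_2\prec\cdots\prec 0_k\prec 1_1\prec\cdots\prec 1_k\prec 2_1\prec\cdots$. It is a $k$-colored generalized Frobenius partition of $n=d+\sum(\text{integer values of all entries})$, and $c\phi_k(n)$ is the number of such partitions of $n$. -}

module Defs where

open import Data.Nat using (ℕ; _+_; _<_)
open import Data.Fin as Fin using (Fin)
open import Data.Product using (Σ; _×_; proj₁)
open import Data.Sum using (_⊎_)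
open import Data.List using (List; length; map)
open import Data.Nat.ListAction using (sum)
open import Data.List.Relation.Unary.Linked using (Linked)
open import Relation.Binary.PropositionalEquality using (_≡_)
open import Function.Bundles using (_↔_)

-- A k-colored nonnegative integer ℓ_c : value ℓ and color c ∈ Fin k
-- (Fin k = {0,…,k-1} stands for colors {1,…,k}).
Colored : ℕ → Set
Colored k = ℕ × Fin k

value : ∀ {k} → Colored k → ℕ
value = proj₁

_≺_ : ∀ {k} → Colored k → Colored k → Set
(a Data.Product., c) ≺ (b Data.Product., c') = (a < b) ⊎ ((a ≡ b) × (c Fin.< c'))

StrictlyDecreasing : ∀ {k} → List (Colored k) → Set
StrictlyDecreasing = Linked (λ x y → y ≺ x)

record FrobeniusPartition (k n : ℕ) : Set where
  constructor frob
  field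
    top       : List (Colored k)
    bottom    : List (Colored k)
    top-dec   : StrictlyDecreasing top
    bot-dec   : StrictlyDecreasing bottom
    same-cols : length top ≡ length bottom
    weight    : length top + sum (map value top) + sum (map value bottom) ≡ n

cφ≡ : ℕ → ℕ → ℕ → Set
cφ≡ k n m = Fin m ↔ FrobeniusPartition k n

{-# OPTIONS --safe #-}

-- A symbol is a choice, at every level (a row and a value), of a subset of the 7 colors. Complementing the bottom row
-- turns it into a finite charge-zero Maya diagram with 7 particles allowed per level, so cφ₇(N) is a coefficient of
-- ∏ₘ (1 + z qᵐ)⁷. Since (1 + y)⁷ = 1 + y⁷ + 7 g(y), modulo 7³ only diagrams with at most two levels that are neither
-- full nor empty matter. None and one are excluded by 7 ∤ N and by charge; two such levels x < y carry t and 7 − t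
-- particles. Emptying one and filling the other turns the background into a partition λ from which an addable ribbon of
-- length D = y − x has been singled out, with N = 7|λ| + tD. A partition has D more addable than removable D-ribbons,
-- and iterating this gives
--   cφ₇(N) ≡ 49 Σ (C(7,t)/7)² D p(n)   (mod 7³)   over 7n + eD = N with e ≡ t (mod 7) and 0 < t < 7.
-- Here (C(7,t)/7)² ≡ e⁴ (mod 7), so the symmetry e ↔ D finishes the proof: e⁴D + D⁴e = eD(e³ + D³) ≡ 0 whenever
-- eD ≡ N is a quadratic nonresidue modulo 7.

module Submission where

open import Defs
open import Data.Empty using (⊥-elim)
open import Data.Fin as Fin using (Fin; toℕ; fromℕ<)
open import Data.Fin.Patterns using (0F; 1F; 2F; 3F; 4F; 5F; 6F)
open import Data.Fin.Properties as Fin using (+↔⊎; all?; toℕ-fromℕ<)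
open import Data.List using (List; []; _∷_; _++_; map; length; downFrom; applyUpTo; replicate)
open import Data.List.Membership.Propositional using (_∈_)
open import Data.List.Properties using (map-downFrom; reverse-applyUpTo)
open import Data.List.Relation.Binary.Permutation.Propositional as ↭ using (_↭_; ↭-refl; ↭-trans; ↭-reflexive)
open import Data.List.Relation.Binary.Permutation.Propositional.Properties using (↭-reverse; ++-comm; ++⁺ʳ; ++⁺ˡ)
open import Data.List.Relation.Binary.Sublist.Propositional using (_⊆_; []; _∷_; _∷ʳ_; minimum; lookup)
open import Data.List.Relation.Binary.Sublist.Propositional.Properties using (All-resp-⊆)
open import Data.List.Relation.Unary.All as All using (All; []; _∷_)
import Data.List.Relation.Unary.All.Properties as All
open import Data.List.Relation.Unary.AllPairs using (AllPairs; []; _∷_)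
open import Data.List.Relation.Unary.Any using (here; there)
open import Data.List.Relation.Unary.Linked as Linked using (Linked)
open import Data.List.Relation.Unary.Linked.Properties using (AllPairs⇒Linked; Linked⇒AllPairs)
open import Data.Nat
open import Data.Nat.Coprimality using (coprime-divisor; coprime?)
open import Data.Nat.Divisibility
open import Data.Nat.DivMod
open import Data.Nat.ListAction using (sum)
open import Data.Nat.Properties
open import Data.Nat.Tactic.RingSolver using (solve-∀)
open import Data.Product using (Σ; ∃; _×_; _,_; proj₁; proj₂; map₂)
open import Data.Product.Function.NonDependent.Propositional using (_×-↔_)
open import Data.Sum using (_⊎_; inj₁; inj₂)
open import Data.Sum.Function.Propositional using (_⊎-↔_)
open import Function using (_∘_; _↔_; mk↔ₛ′)
open import Function.Construct.Composition using (_↔-∘_)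
open import Function.Related.Propositional using (≡⇒)
open import Relation.Binary.PropositionalEquality
open import Relation.Nullary using (¬_; Dec; True; yes; no; contradiction; toWitness)
open import Relation.Nullary.Decidable using (_⊎-dec_; _→-dec_; from-yes)
open import Algebra.Properties.CommutativeSemigroup +-commutativeSemigroup using (interchange; x∙yz≈y∙xz)
import Algebra.Properties.CommutativeSemigroup *-commutativeSemigroup as *-CS
open ≡-Reasoning

-- Finite sums and choices from a list of entries

∑ : {A : Set} → List A → (A → ℕ) → ℕ
∑ []       f = 0
∑ (x ∷ xs) f = f x + ∑ xs f

∑-++ : {A : Set} (xs ys : List A) (f : A → ℕ) → ∑ (xs ++ ys) f ≡ ∑ xs f + ∑ ys f
∑-++ []       ys f = refl
∑-++ (x ∷ xs) ys f = trans (cong (f x +_) (∑-++ xs ys f)) (sym (+-assoc (f x) _ _))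

∑-map : {A B : Set} (g : A → B) (xs : List A) (f : B → ℕ) → ∑ (map g xs) f ≡ ∑ xs (f ∘ g)
∑-map g []       f = refl
∑-map g (x ∷ xs) f = cong (f (g x) +_) (∑-map g xs f)

-- Number of chosen entries and their total.
State : Set
State = ℕ × ℕ

add : ℕ → State → State
add e (c , E) = suc c , e + E

-- The exponents, with multiplicity, of the expanded product of `1 + z q^e` over the entries `e`;
-- `∑ (subs es) f` applies the linear functional given by `f` to that product.
subs : List ℕ → List State
subs []       = (0 , 0) ∷ []
subs (e ∷ es) = subs es ++ map (add e) (subs es)

subs-∷ : ∀ e es f → ∑ (subs (e ∷ es)) f ≡ ∑ (subs es) f + ∑ (subs es) (f ∘ add e)
subs-∷ e es f = trans (∑-++ (subs es) _ f) (cong (∑ (subs es) f +_) (∑-map (add e) (subs es) f))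

-- Frobenius partitions as pairs of sublists

stats : List (Colored 7) → State
stats xs = length xs , sum (map value xs)

Pick : List (Colored 7) → (State → Set) → Set
Pick as Φ = Σ (List (Colored 7)) λ xs → xs ⊆ as × Φ (stats xs)

Pick-[] : ∀ Φ → Φ (0 , 0) ↔ Pick [] Φ
Pick-[] Φ = mk↔ₛ′ (λ φ → [] , [] , φ) (λ { ([] , [] , φ) → φ }) (λ { ([] , [] , φ) → refl }) (λ φ → refl)

Pick-∷ : ∀ a as Φ → (Pick as Φ ⊎ Pick as (Φ ∘ add (value a))) ↔ Pick (a ∷ as) Φ
Pick-∷ a as Φ = mk↔ₛ′
  (λ { (inj₁ (xs , p , φ)) → xs , a ∷ʳ p , φ ; (inj₂ (xs , p , φ)) → a ∷ xs , refl ∷ p , φ })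
  (λ { (xs , _ ∷ʳ p , φ) → inj₁ (xs , p , φ) ; (_ ∷ xs , refl ∷ p , φ) → inj₂ (xs , p , φ) })
  (λ { (xs , _ ∷ʳ p , φ) → refl ; (_ ∷ xs , refl ∷ p , φ) → refl })
  (λ { (inj₁ _) → refl ; (inj₂ _) → refl })

-- `Φ` may be any family of finite types, in particular another type of choices, so nesting this
-- lemma counts both rows.
countPick : ∀ as (f : State → ℕ) Φ → (∀ s → Fin (f s) ↔ Φ s) → Fin (∑ (subs (map value as)) f) ↔ Pick as Φ
countPick []       f Φ h = Pick-[] Φ ↔-∘ (h (0 , 0) ↔-∘ ≡⇒ (cong Fin (+-identityʳ (f (0 , 0)))))
countPick (a ∷ as) f Φ h = Pick-∷ a as Φ
  ↔-∘ ((countPick as f Φ h ⊎-↔ countPick as (f ∘ add (value a)) (Φ ∘ add (value a)) (h ∘ add (value a)))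
  ↔-∘ (+↔⊎ ↔-∘ ≡⇒ (cong Fin (subs-∷ (value a) (map value as) f))))

_≻_ : Colored 7 → Colored 7 → Set
x ≻ y = y ≺ x

≻-irrefl : ∀ {x} → ¬ (x ≻ x)
≻-irrefl (inj₁ p)       = <-irrefl refl p
≻-irrefl (inj₂ (_ , p)) = <-irrefl refl p

≻-trans : ∀ {x y z} → x ≻ y → y ≻ z → x ≻ z
≻-trans (inj₁ p)          (inj₁ q)          = inj₁ (<-trans q p)
≻-trans (inj₁ p)          (inj₂ (refl , _)) = inj₁ p
≻-trans (inj₂ (refl , _)) (inj₁ q)          = inj₁ q
≻-trans (inj₂ (refl , p)) (inj₂ (refl , q)) = inj₂ (refl , <-trans q p)

≻-irrelevant : ∀ {x y} (p q : x ≻ y) → p ≡ q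
≻-irrelevant (inj₁ p)          (inj₁ q)          = cong inj₁ (<-irrelevant p q)
≻-irrelevant (inj₁ p)          (inj₂ (refl , _)) = contradiction p (<-irrefl refl)
≻-irrelevant (inj₂ (refl , _)) (inj₁ q)          = contradiction q (<-irrefl refl)
≻-irrelevant (inj₂ (e , p))    (inj₂ (e' , q))   = cong₂ (λ u v → inj₂ (u , v)) (≡-irrelevant e e') (<-irrelevant p q)

⊆⇒AllPairs : ∀ {xs as : List (Colored 7)} → xs ⊆ as → AllPairs _≻_ as → AllPairs _≻_ xs
⊆⇒AllPairs []         []         = []
⊆⇒AllPairs (_ ∷ʳ p)   (_ ∷ ps)   = ⊆⇒AllPairs p ps
⊆⇒AllPairs (refl ∷ p) (a ∷ ps)   = All-resp-⊆ p a ∷ ⊆⇒AllPairs p ps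

-- A strictly decreasing list has no repetitions; in the mixed cases the head would occur again
-- strictly below itself.
⊆-irrelevant : ∀ {xs as : List (Colored 7)} → AllPairs _≻_ as → (p q : xs ⊆ as) → p ≡ q
⊆-irrelevant _        []         []         = refl
⊆-irrelevant (_ ∷ ps) (a ∷ʳ p)   (.a ∷ʳ q)  = cong (a ∷ʳ_) (⊆-irrelevant ps p q)
⊆-irrelevant (_ ∷ ps) (refl ∷ p) (refl ∷ q) = cong (refl ∷_) (⊆-irrelevant ps p q)
⊆-irrelevant (a> ∷ _) (_ ∷ʳ p)   (refl ∷ q) = ⊥-elim (≻-irrefl (All.lookup a> (lookup p (here refl))))
⊆-irrelevant (a> ∷ _) (refl ∷ p) (_ ∷ʳ q)   = ⊥-elim (≻-irrefl (All.lookup a> (lookup q (here refl))))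

drop-max : ∀ {a as xs} → All (a ≻_) xs → All (_∈ (a ∷ as)) xs → All (_∈ as) xs
drop-max []       []               = []
drop-max (p ∷ _)  (here refl ∷ _)  = ⊥-elim (≻-irrefl p)
drop-max (_ ∷ ps) (there i ∷ is)   = i ∷ drop-max ps is

decreasing⇒⊆ : ∀ {as xs} → AllPairs _≻_ as → AllPairs _≻_ xs → All (_∈ as) xs → xs ⊆ as
decreasing⇒⊆ {[]}     _          []         _                = []
decreasing⇒⊆ {[]}     _          (_ ∷ _)    (() ∷ _)
decreasing⇒⊆ {a ∷ as} (_ ∷ _)    []         []               = minimum _
decreasing⇒⊆ {a ∷ as} (_ ∷ as≻)  (x> ∷ xs≻) (here refl ∷ is) = refl ∷ decreasing⇒⊆ as≻ xs≻ (drop-max x> is)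
decreasing⇒⊆ {a ∷ as} (a> ∷ as≻) (x> ∷ xs≻) (there i ∷ is)   =
  a ∷ʳ decreasing⇒⊆ as≻ (x> ∷ xs≻) (i ∷ drop-max (All.map (≻-trans (All.lookup a> i)) x>) is)

-- Listed in decreasing order, so that the strictly decreasing rows with values below `L` are
-- exactly its sublists.
atoms : ℕ → List (Colored 7)
atoms zero    = []
atoms (suc L) = (L , 6F) ∷ (L , 5F) ∷ (L , 4F) ∷ (L , 3F) ∷ (L , 2F) ∷ (L , 1F) ∷ (L , 0F) ∷ atoms L

∈-atoms : ∀ {L ℓ c} → ℓ < L → (ℓ , c) ∈ atoms L
∈-atoms {suc L} {ℓ} {c} (s≤s ℓ≤L) with m≤n⇒m<n∨m≡n ℓ≤L
... | inj₁ ℓ<L = there (there (there (there (there (there (there (∈-atoms ℓ<L)))))))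
... | inj₂ refl with c
...   | 6F = here refl
...   | 5F = there (here refl)
...   | 4F = there (there (here refl))
...   | 3F = there (there (there (here refl)))
...   | 2F = there (there (there (there (here refl))))
...   | 1F = there (there (there (there (there (here refl)))))
...   | 0F = there (there (there (there (there (there (here refl))))))

atoms-bounded : ∀ L → All (λ a → value a < L) (atoms L)
atoms-bounded zero    = []
atoms-bounded (suc L) = l ∷ l ∷ l ∷ l ∷ l ∷ l ∷ l ∷ All.map m≤n⇒m≤1+n (atoms-bounded L)
  where l = n<1+n L

atoms-decreasing : ∀ L → AllPairs _≻_ (atoms L)
atoms-decreasing zero    = []
atoms-decreasing (suc L) =
  (i ∷ i ∷ i ∷ i ∷ i ∷ i ∷ b) ∷ (i ∷ i ∷ i ∷ i ∷ i ∷ b) ∷ (i ∷ i ∷ i ∷ i ∷ b) ∷ (i ∷ i ∷ i ∷ b) ∷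
  (i ∷ i ∷ b) ∷ (i ∷ b) ∷ b ∷ atoms-decreasing L
  where
  b : ∀ {c} → All ((L , c) ≻_) (atoms L)
  b = All.map inj₁ (atoms-bounded L)
  i : ∀ {c d} {lt : True (d Fin.<? c)} → (L , c) ≻ (L , d)
  i {lt = lt} = inj₂ (refl , toWitness lt)

values≤sum : ∀ (xs : List (Colored 7)) → All (λ x → value x ≤ sum (map value xs)) xs
values≤sum []       = []
values≤sum (x ∷ xs) = m≤m+n _ _ ∷ All.map (λ p → ≤-trans p (m≤n+m _ _)) (values≤sum xs)

-- No entry exceeds the sum of all values, so the cut-off at `L` loses nothing.
strictly-decreasing⇒⊆ : ∀ {L xs} → StrictlyDecreasing xs → sum (map value xs) < L → xs ⊆ atoms L
strictly-decreasing⇒⊆ {L} {xs} d s<L = decreasing⇒⊆ (atoms-decreasing L)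
  (Linked⇒AllPairs (λ {x} {y} {z} → ≻-trans {x} {y} {z}) d) (All.map (λ p → ∈-atoms (≤-<-trans p s<L)) (values≤sum xs))

⊆⇒strictly-decreasing : ∀ {L xs} → xs ⊆ atoms L → StrictlyDecreasing xs
⊆⇒strictly-decreasing {L} p = AllPairs⇒Linked (⊆⇒AllPairs p (atoms-decreasing L))

δ : ℕ → ℕ → ℕ
δ zero    zero    = 1
δ zero    (suc _) = 0
δ (suc _) zero    = 0
δ (suc m) (suc n) = δ m n

δ↔≡ : ∀ m n → Fin (δ m n) ↔ (m ≡ n)
δ↔≡ zero    zero    = mk↔ₛ′ (λ _ → refl) (λ _ → 0F) (λ { refl → refl }) (λ { 0F → refl ; (Fin.suc ()) })
δ↔≡ zero    (suc n) = mk↔ₛ′ (λ ()) (λ ()) (λ ()) (λ ())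
δ↔≡ (suc m) zero    = mk↔ₛ′ (λ ()) (λ ()) (λ ()) (λ ())
δ↔≡ (suc m) (suc n) = mk↔ₛ′ (cong suc) suc-injective (λ _ → ≡-irrelevant _ _) (λ _ → ≡-irrelevant _ _) ↔-∘ δ↔≡ m n

×↔* : ∀ {m n} {A B : Set} → Fin m ↔ A → Fin n ↔ B → Fin (m * n) ↔ (A × B)
×↔* f g = (f ×-↔ g) ↔-∘ Fin.*↔×

frobeniusTest : ℕ → State → State → ℕ
frobeniusTest N (c , E) (c' , E') = δ c c' * δ (c + E + E') N

frobeniusCount : ℕ → ℕ → ℕ
frobeniusCount L N = ∑ (subs (map value (atoms L))) λ s → ∑ (subs (map value (atoms L))) (frobeniusTest N s)

-- Proofs of order and of embedding are unique, so a partition and its pair of sublists determine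
-- each other.
cφ-count : ∀ {L N} → N < L → cφ≡ 7 N (frobeniusCount L N)
cφ-count {L} {N} N<L = mk↔ₛ′ to from to∘from from∘to
  ↔-∘ countPick (atoms L) _ (λ s → Pick (atoms L) (Φ s))
        (λ s → countPick (atoms L) (frobeniusTest N s) (Φ s) (λ s' → ×↔* (δ↔≡ _ _) (δ↔≡ _ _)))
  where
  Φ : State → State → Set
  Φ (c , E) (c' , E') = (c ≡ c') × (c + E + E' ≡ N)
  to : Pick (atoms L) (λ s → Pick (atoms L) (Φ s)) → FrobeniusPartition 7 N
  to (xs , p , ys , q , l , w) = frob xs ys (⊆⇒strictly-decreasing p) (⊆⇒strictly-decreasing q) l w
  from : FrobeniusPartition 7 N → Pick (atoms L) (λ s → Pick (atoms L) (Φ s))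
  from (frob xs ys dx dy l w) =
      xs , strictly-decreasing⇒⊆ dx (≤-<-trans (≤-trans (m≤n+m _ (length xs)) (m≤m+n _ _)) w<L)
    , ys , strictly-decreasing⇒⊆ dy (≤-<-trans (m≤n+m _ (length xs + sum (map value xs))) w<L) , l , w
    where w<L = subst (_< L) (sym w) N<L
  to∘from : ∀ π → to (from π) ≡ π
  to∘from (frob xs ys dx dy l w) = cong₂ (λ u v → frob xs ys u v l w) (irr _ _) (irr _ _)
    where irr : ∀ {xs} (p q : StrictlyDecreasing xs) → p ≡ q
          irr = Linked.irrelevant (λ {x} {y} → ≻-irrelevant {x} {y})
  from∘to : ∀ t → from (to t) ≡ t
  from∘to (xs , p , ys , q , l , w) =
    cong₂ (λ u v → xs , u , ys , v , l , w) (⊆-irrelevant (atoms-decreasing L) _ _) (⊆-irrelevant (atoms-decreasing L) _ _)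

-- Sums over choices under concatenation, shift, complement and permutation

∑-cong-All : {A : Set} {P : A → Set} {xs : List A} {f g : A → ℕ} → All P xs → (∀ x → P x → f x ≡ g x) → ∑ xs f ≡ ∑ xs g
∑-cong-All []       h = refl
∑-cong-All (p ∷ ps) h = cong₂ _+_ (h _ p) (∑-cong-All ps h)

∑-cong : {A : Set} (xs : List A) {f g : A → ℕ} → (∀ x → f x ≡ g x) → ∑ xs f ≡ ∑ xs g
∑-cong []       h = refl
∑-cong (x ∷ xs) h = cong₂ _+_ (h x) (∑-cong xs h)

∑-zero : {A : Set} (xs : List A) → ∑ xs (λ _ → 0) ≡ 0
∑-zero []       = refl
∑-zero (x ∷ xs) = ∑-zero xs

∑-+ : {A : Set} (xs : List A) (f g : A → ℕ) → ∑ xs (λ x → f x + g x) ≡ ∑ xs f + ∑ xs g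
∑-+ []       f g = refl
∑-+ (x ∷ xs) f g rewrite ∑-+ xs f g = interchange (f x) (g x) (∑ xs f) (∑ xs g)

∑-* : {A : Set} (xs : List A) (k : ℕ) (f : A → ℕ) → ∑ xs (λ x → k * f x) ≡ k * ∑ xs f
∑-* []       k f = sym (*-zeroʳ k)
∑-* (x ∷ xs) k f rewrite ∑-* xs k f = sym (*-distribˡ-+ k (f x) (∑ xs f))

∑-swap : {A B : Set} (xs : List A) (ys : List B) (f : A → B → ℕ) →
         ∑ xs (λ x → ∑ ys (f x)) ≡ ∑ ys (λ y → ∑ xs (λ x → f x y))
∑-swap []       ys f = sym (∑-zero ys)
∑-swap (x ∷ xs) ys f = trans (cong (∑ ys (f x) +_) (∑-swap xs ys f)) (sym (∑-+ ys (f x) _))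

subs-++ : ∀ xs ys f → ∑ (subs (xs ++ ys)) f ≡
          ∑ (subs xs) λ s → ∑ (subs ys) λ t → f (proj₁ s + proj₁ t , proj₂ s + proj₂ t)
subs-++ []       ys f = sym (+-identityʳ _)
subs-++ (x ∷ xs) ys f = begin
  ∑ (subs (x ∷ xs ++ ys)) f
    ≡⟨ subs-∷ x (xs ++ ys) f ⟩
  ∑ (subs (xs ++ ys)) f + ∑ (subs (xs ++ ys)) (f ∘ add x)
    ≡⟨ cong₂ _+_ (subs-++ xs ys f) (trans (subs-++ xs ys (f ∘ add x)) (∑-cong (subs xs) λ s → ∑-cong (subs ys) λ t →
         cong (λ e → f (suc (proj₁ s + proj₁ t) , e)) (sym (+-assoc x (proj₂ s) (proj₂ t))))) ⟩
  _ ≡⟨ subs-∷ x xs _ ⟨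
  _ ∎

subs-shift : ∀ k es f → ∑ (subs (map (k +_) es)) f ≡ ∑ (subs es) λ s → f (proj₁ s , k * proj₁ s + proj₂ s)
subs-shift k []       f = cong (λ e → f (0 , e) + 0) (sym (trans (+-identityʳ (k * 0)) (*-zeroʳ k)))
subs-shift k (e ∷ es) f = begin
  _ ≡⟨ subs-∷ (k + e) (map (k +_) es) f ⟩
  _ ≡⟨ cong₂ _+_ (subs-shift k es f) (trans (subs-shift k es _) (∑-cong (subs es) λ s →
         cong (λ d → f (suc (proj₁ s) , d)) (lemma k e (proj₁ s) (proj₂ s)))) ⟩
  _ ≡⟨ subs-∷ e es _ ⟨
  _ ∎
  where
  lemma : ∀ k e c E → k + e + (k * c + E) ≡ k * suc c + (e + E)
  lemma = solve-∀

-- Choosing `e` on one side means not choosing `ℓ ∸ e` on the other. The relation between `E` and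
-- `E′` is `E′ = ℓ c′ − (sum es − E)`, freed of subtractions.
subs-complement : ∀ {ℓ es} → All (_≤ ℓ) es → ∀ ψ ψ′ →
  (∀ c E c′ E′ → c + c′ ≡ length es → E′ + sum es ≡ ℓ * c′ + E → ψ (c , E) ≡ ψ′ (c′ , E′)) →
  ∑ (subs es) ψ ≡ ∑ (subs (map (ℓ ∸_) es)) ψ′
subs-complement {ℓ} [] ψ ψ′ h = cong (_+ 0) (h 0 0 0 0 refl (sym (trans (+-identityʳ (ℓ * 0)) (*-zeroʳ ℓ))))
subs-complement {ℓ} {e ∷ es} (e≤ℓ ∷ es≤ℓ) ψ ψ′ h = begin
  _ ≡⟨ subs-∷ e es ψ ⟩
  ∑ (subs es) ψ + ∑ (subs es) (ψ ∘ add e)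
    ≡⟨ cong₂ _+_
        (subs-complement es≤ℓ ψ (ψ′ ∘ add (ℓ ∸ e)) λ c E c′ E′ p q →
          h _ _ _ _ (trans (+-suc c c′) (cong suc p))
            (begin
               ℓ ∸ e + E′ + (e + sum es)   ≡⟨ interchange (ℓ ∸ e) E′ e (sum es) ⟩
               (ℓ ∸ e + e) + (E′ + sum es) ≡⟨ cong₂ _+_ (m∸n+n≡m e≤ℓ) q ⟩
               ℓ + (ℓ * c′ + E)            ≡⟨ lemma ℓ c′ E ⟩
               ℓ * suc c′ + E              ∎))
        (subs-complement es≤ℓ (ψ ∘ add e) ψ′ λ c E c′ E′ p q →
          h _ _ _ _ (cong suc p)
            (begin
               E′ + (e + sum es) ≡⟨ x∙yz≈y∙xz E′ e (sum es) ⟩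
               e + (E′ + sum es) ≡⟨ cong (e +_) q ⟩
               e + (ℓ * c′ + E)  ≡⟨ x∙yz≈y∙xz e (ℓ * c′) E ⟩
               ℓ * c′ + (e + E)  ∎)) ⟩
  _ ≡⟨ +-comm _ (∑ (subs (map (ℓ ∸_) es)) ψ′) ⟩
  _ ≡⟨ subs-∷ (ℓ ∸ e) (map (ℓ ∸_) es) ψ′ ⟨
  _ ∎
  where
  lemma : ∀ l c E → l + (l * c + E) ≡ l * suc c + E
  lemma = solve-∀

subs-↭ : ∀ {xs ys} → xs ↭ ys → ∀ f → ∑ (subs xs) f ≡ ∑ (subs ys) f
subs-↭ ↭.refl        f = refl
subs-↭ (↭.trans p q) f = trans (subs-↭ p f) (subs-↭ q f)
subs-↭ {x ∷ xs} {_ ∷ ys} (↭.prep x p) f = begin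
  _ ≡⟨ subs-∷ x xs f ⟩
  _ ≡⟨ cong₂ _+_ (subs-↭ p f) (subs-↭ p (f ∘ add x)) ⟩
  _ ≡⟨ subs-∷ x ys f ⟨
  _ ∎
subs-↭ {x ∷ y ∷ xs} {_ ∷ _ ∷ ys} (↭.swap x y p) f = begin
  _ ≡⟨ subs-∷ x (y ∷ xs) f ⟩
  _ ≡⟨ cong₂ _+_ (subs-∷ y xs f) (subs-∷ y xs (f ∘ add x)) ⟩
  (∑ (subs xs) f + ∑ (subs xs) (f ∘ add y)) + (∑ (subs xs) (f ∘ add x) + ∑ (subs xs) (f ∘ add x ∘ add y))
    ≡⟨ interchange (∑ (subs xs) f) _ _ _ ⟩
  (∑ (subs xs) f + ∑ (subs xs) (f ∘ add x)) + (∑ (subs xs) (f ∘ add y) + ∑ (subs xs) (f ∘ add x ∘ add y))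
    ≡⟨ cong₂ _+_ (cong₂ _+_ (subs-↭ p f) (subs-↭ p (f ∘ add x)))
                 (cong₂ _+_ (subs-↭ p (f ∘ add y)) (trans (subs-↭ p (f ∘ add x ∘ add y)) (∑-cong (subs ys) λ s →
                    cong (λ e → f (suc (suc (proj₁ s)) , e)) (x∙yz≈y∙xz x y (proj₂ s))))) ⟩
  (∑ (subs ys) f + ∑ (subs ys) (f ∘ add x)) + (∑ (subs ys) (f ∘ add y) + ∑ (subs ys) (f ∘ add y ∘ add x))
    ≡⟨ cong₂ _+_ (subs-∷ x ys f) (subs-∷ x ys (f ∘ add y)) ⟨
  _ ≡⟨ subs-∷ y (x ∷ ys) f ⟨
  _ ∎

-- Passage to Maya diagrams

levels : ℕ → List ℕ
levels K = map value (atoms K)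

seven : List ℕ → List ℕ
seven []       = []
seven (x ∷ xs) = replicate 7 x ++ seven xs

seven-↭ : ∀ {xs ys} → xs ↭ ys → seven xs ↭ seven ys
seven-↭ ↭.refl         = ↭-refl
seven-↭ (↭.prep x p)   = ++⁺ˡ (replicate 7 x) (seven-↭ p)
seven-↭ (↭.trans p q)  = ↭-trans (seven-↭ p) (seven-↭ q)
seven-↭ {ys = _ ∷ _ ∷ ys} (↭.swap x y p) = ↭-trans (++⁺ˡ (replicate 7 x ++ replicate 7 y) (seven-↭ p))
                                 (++⁺ʳ (seven ys) (++-comm (replicate 7 x) (replicate 7 y)))

map-seven : ∀ f xs → map f (seven xs) ≡ seven (map f xs)
map-seven f []       = refl
map-seven f (x ∷ xs) = cong (replicate 7 (f x) ++_) (map-seven f xs)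

levels≡seven : ∀ K → levels K ≡ seven (downFrom K)
levels≡seven zero    = refl
levels≡seven (suc K) = cong (replicate 7 K ++_) (levels≡seven K)

reflect-upTo : ∀ ℓ → applyUpTo (ℓ ∸_) (suc ℓ) ≡ downFrom (suc ℓ)
reflect-upTo zero    = refl
reflect-upTo (suc ℓ) = cong (suc ℓ ∷_) (reflect-upTo ℓ)

reflect-downFrom : ∀ ℓ → map (ℓ ∸_) (downFrom (suc ℓ)) ↭ downFrom (suc ℓ)
reflect-downFrom ℓ = ↭-trans
  (↭-reflexive (trans (map-downFrom (ℓ ∸_) (suc ℓ)) (sym (reverse-applyUpTo (ℓ ∸_) (suc ℓ)))))
  (↭-trans (↭-reverse _) (↭-reflexive (reflect-upTo ℓ)))

reflect-levels : ∀ ℓ → map (ℓ ∸_) (levels (suc ℓ)) ↭ levels (suc ℓ)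
reflect-levels ℓ = ↭-trans
  (↭-reflexive (trans (cong (map (ℓ ∸_)) (levels≡seven (suc ℓ))) (map-seven (ℓ ∸_) (downFrom (suc ℓ)))))
  (↭-trans (seven-↭ (reflect-downFrom ℓ)) (↭-reflexive (sym (levels≡seven (suc ℓ)))))

levels-+ : ∀ n L → levels (n + L) ≡ map (L +_) (levels n) ++ levels L
levels-+ zero    L = refl
levels-+ (suc n) L = cong₂ (λ e es → replicate 7 e ++ es) (+-comm n L) (levels-+ n L)

-- The sum `0 + … + (c − 1)`, which is the least total of `c` distinct levels.
tri : ℕ → ℕ
tri zero    = 0
tri (suc c) = c + tri c

tri-double : ∀ L → tri L + tri L + L ≡ L * L
tri-double zero    = refl
tri-double (suc c) = trans (lemma c (tri c)) (trans (cong (λ q → q + suc (c + c)) (tri-double c)) (lemma′ c))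
  where
  lemma : ∀ c t → c + t + (c + t) + suc c ≡ t + t + c + suc (c + c)
  lemma = solve-∀
  lemma′ : ∀ c → c * c + suc (c + c) ≡ suc c * suc c
  lemma′ = solve-∀

sum-levels : ∀ L → sum (levels L) ≡ 7 * tri L
sum-levels zero    = refl
sum-levels (suc L) = trans (cong (λ s → L + (L + (L + (L + (L + (L + (L + s))))))) (sum-levels L)) (lemma L (tri L))
  where lemma : ∀ L t → L + (L + (L + (L + (L + (L + (L + 7 * t)))))) ≡ 7 * (L + t)
        lemma = solve-∀

length-levels : ∀ L → length (levels L) ≡ 7 * L
length-levels zero    = refl
length-levels (suc L) = trans (cong (7 +_) (length-levels L)) (sym (*-suc 7 L))

levels-bounded : ∀ ℓ → All (_≤ ℓ) (levels (suc ℓ))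
levels-bounded ℓ = All.map⁺ (All.map s≤s⁻¹ (atoms-bounded (suc ℓ)))

δ-refl : ∀ m → δ m m ≡ 1
δ-refl zero    = refl
δ-refl (suc m) = δ-refl m

δ-≢ : ∀ {m n} → m ≢ n → δ m n ≡ 0
δ-≢ {zero}  {zero}  h = contradiction refl h
δ-≢ {zero}  {suc n} h = refl
δ-≢ {suc m} {zero}  h = refl
δ-≢ {suc m} {suc n} h = δ-≢ (h ∘ cong suc)

δ-+ˡ : ∀ k m n → δ (k + m) (k + n) ≡ δ m n
δ-+ˡ zero    m n = refl
δ-+ˡ (suc k) m n = δ-+ˡ k m n

δ-+ʳ : ∀ k m n → δ (m + k) (n + k) ≡ δ m n
δ-+ʳ k m n = trans (cong₂ δ (+-comm m k) (+-comm n k)) (δ-+ˡ k m n)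

δ-*ˡ : ∀ k m n → δ (suc k * m) (suc k * n) ≡ δ m n
δ-*ˡ k m n with m ≟ n
... | yes refl = trans (δ-refl (suc k * m)) (sym (δ-refl m))
... | no m≢n   = trans (δ-≢ (m≢n ∘ *-cancelˡ-≡ m n (suc k))) (sym (δ-≢ m≢n))

-- The vacuum fills the levels below L and has energy 7 * tri L.
mayaTest : ℕ → ℕ → State → ℕ
mayaTest L N (c , E) = δ c (7 * L) * δ E (7 * tri L + N)

-- A top entry `e` becomes a particle at level `L + e`, a bottom entry `e` a hole at level `ℓ ∸ e`,
-- where `ℓ = L − 1`. Equal row lengths mean charge zero, and each column costs `L − ℓ = 1` beyond
-- its two entries, which is the summand `d` of the weight.
frobenius≡maya : ∀ {L} → 0 < L → ∀ N → frobeniusCount L N ≡ ∑ (subs (levels (L + L))) (mayaTest L N)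
frobenius≡maya {suc ℓ} _ N = sym (begin
  ∑ (subs (levels (L + L))) (mayaTest L N)
    ≡⟨ cong (λ es → ∑ (subs es) (mayaTest L N)) (levels-+ L L) ⟩
  ∑ (subs (map (L +_) (levels L) ++ levels L)) (mayaTest L N)
    ≡⟨ subs-++ (map (L +_) (levels L)) (levels L) _ ⟩
  _ ≡⟨ subs-shift L (levels L) _ ⟩
  _ ≡⟨ ∑-cong (subs (levels L)) (λ s → trans (sym (subs-↭ (reflect-levels ℓ) _))
         (sym (subs-complement (levels-bounded ℓ) _ _ (λ c′ E′ c″ E″ p q →
            pointwise (proj₁ s) (proj₂ s) c′ E′ c″ E″ (trans p (length-levels L))
              (trans (cong (E″ +_) (sym (sum-levels L))) q))))) ⟩
  frobeniusCount L N ∎)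
  where
  L = suc ℓ
  -- The extra `7 * suc ℓ` on both sides completes `T + T` to the square provided by `tri-double`;
  -- `pointwise` cancels it again.
  energy : ∀ ℓ c E b e c″ T → c″ + c ≡ b → T + T + suc ℓ ≡ suc ℓ * suc ℓ → b ≡ 7 * suc ℓ →
           (ℓ * c″ + e) + (suc ℓ * c + E) + 7 * suc ℓ  ≡ 7 * (T + T) + (c + E + e) + 7 * suc ℓ
  energy ℓ c E b e c″ T refl t q = begin
    ℓ * c″ + e + (suc ℓ * c + E) + 7 * suc ℓ           ≡⟨ l₁ ℓ c″ e c E ⟩
    ℓ * (c″ + c) + 7 * suc ℓ + (c + E + e)       ≡⟨ cong (λ b → ℓ * b + 7 * suc ℓ + (c + E + e)) q ⟩
    ℓ * (7 * suc ℓ) + 7 * suc ℓ + (c + E + e)    ≡⟨ l₂ ℓ (c + E + e) ⟩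
    7 * (suc ℓ * suc ℓ) + (c + E + e)            ≡⟨ cong (λ u → 7 * u + (c + E + e)) t ⟨
    7 * (T + T + suc ℓ) + (c + E + e)            ≡⟨ l₃ ℓ T (c + E + e) ⟩
    7 * (T + T) + (c + E + e) + 7 * suc ℓ        ∎
    where
    l₁ : ∀ ℓ c″ e c E → ℓ * c″ + e + (suc ℓ * c + E) + 7 * suc ℓ ≡ ℓ * (c″ + c) + 7 * suc ℓ + (c + E + e)
    l₁ = solve-∀
    l₂ : ∀ ℓ u → ℓ * (7 * suc ℓ) + 7 * suc ℓ + u ≡ 7 * (suc ℓ * suc ℓ) + u
    l₂ = solve-∀
    l₃ : ∀ ℓ T u → 7 * (T + T + suc ℓ) + u ≡ 7 * (T + T) + u + 7 * suc ℓ
    l₃ = solve-∀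
  pointwise : ∀ c E c′ E′ c″ E″ → c′ + c″ ≡ 7 * L → E″ + 7 * tri L ≡ ℓ * c″ + E′ →
    δ c c′ * δ (c + E + E′) N ≡ δ (c + c″) (7 * L) * δ (L * c + E + E″) (7 * tri L + N)
  pointwise c E c′ E′ c″ E″ p q with c ≟ c′
  ... | no c≢c′  = trans (cong (_* δ (c + E + E′) N) (δ-≢ c≢c′))
                    (sym (cong (_* δ (L * c + E + E″) (7 * tri L + N))
                           (trans (cong (δ (c + c″)) (sym p)) (trans (δ-+ʳ c″ c c′) (δ-≢ c≢c′)))))
  ... | yes refl = cong₂ _*_ (trans (δ-refl c) (sym (trans (cong (δ (c + c″)) (sym p)) (δ-refl (c + c″))))) (sym (begin
    δ (L * c + E + E″) (7 * tri L + N)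
      ≡⟨ δ-+ʳ (7 * tri L) (L * c + E + E″) (7 * tri L + N) ⟨
    δ (L * c + E + E″ + 7 * tri L) (7 * tri L + N + 7 * tri L)
      ≡⟨ cong₂ δ (trans (+-assoc (L * c + E) E″ _) (trans (cong (L * c + E +_) q) (+-comm (L * c + E) _))) (l₄ (tri L) N) ⟩
    δ (ℓ * c″ + E′ + (L * c + E)) (7 * (tri L + tri L) + N)
      ≡⟨ cong (λ u → δ u (7 * (tri L + tri L) + N))
           (+-cancelʳ-≡ (7 * L) _ _ (energy ℓ c E _ E′ c″ (tri L) refl (tri-double L) (trans (+-comm c″ c) p))) ⟩
    δ (7 * (tri L + tri L) + (c + E + E′)) (7 * (tri L + tri L) + N)
      ≡⟨ δ-+ˡ (7 * (tri L + tri L)) _ _ ⟩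
    δ (c + E + E′) N ∎))
    where
    l₄ : ∀ t N → 7 * t + N + 7 * t ≡ 7 * (t + t) + N
    l₄ = solve-∀

-- Expansion modulo 343

times : ℕ → ℕ → State → State
times zero    x s = s
times (suc t) x s = add x (times t x s)

add-comm : ∀ x y s → add x (add y s) ≡ add y (add x s)
add-comm x y (c , E) = cong (suc (suc c) ,_) (x∙yz≈y∙xz x y E)

times-add : ∀ t x y s → times t x (add y s) ≡ add y (times t x s)
times-add zero    x y s = refl
times-add (suc t) x y s = trans (cong (add x) (times-add t x y s)) (add-comm x y _)

times-comm : ∀ t x u y s → times t x (times u y s) ≡ times u y (times t x s)
times-comm t x zero    y s = refl
times-comm t x (suc u) y s = trans (times-add t x y _) (cong (add y) (times-comm t x u y s))

times-≡ : ∀ t x c E → times t x (c , E) ≡ (t + c , t * x + E)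
times-≡ zero    x c E = refl
times-≡ (suc t) x c E = trans (cong (add x) (times-≡ t x c E)) (cong (suc (t + c) ,_) (sym (+-assoc x (t * x) E)))

-- w t = C(7,t)/7 for 0 < t < 7.
w : ℕ → ℕ
w 1 = 1
w 2 = 3
w 3 = 5
w 4 = 5
w 5 = 3
w 6 = 1
w _ = 0

opaque
  -- Replaces `y^t` by `f t` in the polynomial `g(y)` with `(1 + y)⁷ = 1 + y⁷ + 7 g(y)`. Being
  -- opaque, it stays folded in later goals.
  weighted : (ℕ → ℕ) → ℕ
  weighted f = ∑ (downFrom 7) λ t → w t * f t

  weighted-explicit : ∀ f → weighted f ≡ 1 * f 6 + (3 * f 5 + (5 * f 4 + (5 * f 3 + (3 * f 2 + (1 * f 1 + 0)))))
  weighted-explicit f = refl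

  weighted-cong : ∀ {f g : ℕ → ℕ} → (∀ t → f t ≡ g t) → weighted f ≡ weighted g
  weighted-cong h = ∑-cong (downFrom 7) λ t → cong (w t *_) (h t)

  weighted-+ : ∀ f g → weighted (λ t → f t + g t) ≡ weighted f + weighted g
  weighted-+ f g = trans (∑-cong (downFrom 7) λ t → *-distribˡ-+ (w t) (f t) (g t))
                         (∑-+ (downFrom 7) (λ t → w t * f t) (λ t → w t * g t))

  weighted-* : ∀ k f → weighted (λ t → k * f t) ≡ k * weighted f
  weighted-* k f = trans (∑-cong (downFrom 7) λ t → *-CS.x∙yz≈y∙xz (w t) k (f t)) (∑-* (downFrom 7) k λ t → w t * f t)

  ∑-weighted : {A : Set} (xs : List A) (f : ℕ → A → ℕ) →
               ∑ xs (λ x → weighted λ t → f t x) ≡ weighted λ t → ∑ xs (f t)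
  ∑-weighted xs f = trans (∑-swap xs (downFrom 7) (λ x t → w t * f t x)) (∑-cong (downFrom 7) λ t → ∑-* xs (w t) (f t))

  weighted-swap : ∀ (f : ℕ → ℕ → ℕ) → weighted (λ t → weighted (f t)) ≡ weighted λ u → weighted λ t → f t u
  weighted-swap f = trans (∑-cong (downFrom 7) (λ t → sym (weighted-* (w t) (f t))))
                          (∑-weighted (downFrom 7) λ u t → w t * f t u)

-- Puts `t` particles on level `x`, with `0 < t < 7` because `w` vanishes elsewhere.
partial : ℕ → (State → ℕ) → State → ℕ
partial x f s = weighted λ t → f (times t x s)

-- Every level is full or empty.
pure : (State → ℕ) → State → ℕ
pure f (c , E) = f (7 * c , 7 * E)

pure-add : ∀ K f s → pure f (add K s) ≡ pure (f ∘ times 7 K) s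
pure-add K f (c , E) = cong₂ (λ a b → f (a , b)) (*-suc 7 c) (lemma K E)
  where lemma : ∀ K E → 7 * (K + E) ≡ K + (K + (K + (K + (K + (K + (K + 7 * E))))))
        lemma = solve-∀

-- Distinguished levels x, resp. x < y, of {0,…,K-1} together with a subset of the remaining levels.
pick : ℕ → List (ℕ × State)
pick zero    = []
pick (suc K) = pick K ++ (map (map₂ (add K)) (pick K) ++ map (K ,_) (subs (downFrom K)))

pair : ℕ → List ((ℕ × ℕ) × State)
pair zero    = []
pair (suc K) = pair K ++ (map (map₂ (add K)) (pair K) ++ map (λ (x , s) → (x , K) , s) (pick K))

∑-pick : ∀ K f → ∑ (pick (suc K)) f ≡
  ∑ (pick K) f + (∑ (pick K) (λ (x , s) → f (x , add K s)) + ∑ (subs (downFrom K)) (λ s → f (K , s)))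
∑-pick K f = trans (∑-++ (pick K) _ f) (cong (∑ (pick K) f +_) (trans (∑-++ (map (map₂ (add K)) (pick K)) _ f)
  (cong₂ _+_ (∑-map _ (pick K) f) (∑-map _ (subs (downFrom K)) f))))

∑-pair : ∀ K f → ∑ (pair (suc K)) f ≡
  ∑ (pair K) f + (∑ (pair K) (λ (xy , s) → f (xy , add K s)) + ∑ (pick K) (λ (x , s) → f ((x , K) , s)))
∑-pair K f = trans (∑-++ (pair K) _ f) (cong (∑ (pair K) f +_) (trans (∑-++ (map (map₂ (add K)) (pair K)) _ f)
  (cong₂ _+_ (∑-map _ (pair K) f) (∑-map _ (pick K) f))))

-- Contributions of the diagrams with 0, 1, 2 levels neither full nor empty, divided by 1, 7, 49.
Z₀ Z₁ Z₂ : ℕ → (State → ℕ) → ℕ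
Z₀ K f = ∑ (subs (downFrom K)) (pure f)
Z₁ K f = ∑ (pick K) λ (x , s) → pure (partial x f) s
Z₂ K f = ∑ (pair K) λ ((x , y) , s) → pure (partial x (partial y f)) s

-- The three recursions distinguish whether the top level `K` is empty, full, or one of the
-- partially filled levels.
Z₀-suc : ∀ K f → Z₀ (suc K) f ≡ Z₀ K f + Z₀ K (f ∘ times 7 K)
Z₀-suc K f = trans (subs-∷ K (downFrom K) (pure f)) (cong (Z₀ K f +_) (∑-cong (subs (downFrom K)) (pure-add K f)))

Z₁-suc : ∀ K f → Z₁ (suc K) f ≡ Z₁ K f + (Z₁ K (f ∘ times 7 K) + weighted (λ t → Z₀ K (f ∘ times t K)))
Z₁-suc K f = trans (∑-pick K (λ (x , s) → pure (partial x f) s)) (cong (Z₁ K f +_) (cong₂ _+_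
  (∑-cong (pick K) λ (x , s) → trans (pure-add K (partial x f) s)
     (weighted-cong λ t → cong f (times-comm t x 7 K _)))
  (∑-weighted (subs (downFrom K)) λ t → pure (f ∘ times t K))))

Z₂-suc : ∀ K f → Z₂ (suc K) f ≡ Z₂ K f + (Z₂ K (f ∘ times 7 K) + weighted (λ t → Z₁ K (f ∘ times t K)))
Z₂-suc K f = trans (∑-pair K (λ ((x , y) , s) → pure (partial x (partial y f)) s)) (cong (Z₂ K f +_) (cong₂ _+_
  (∑-cong (pair K) λ ((x , y) , s) → trans (pure-add K (partial x (partial y f)) s)
     (weighted-cong λ t → weighted-cong λ u → cong f
        (trans (cong (times u y) (times-comm t x 7 K _)) (times-comm u y 7 K _))))
  (trans (∑-cong (pick K) (λ (x , s) → weighted-swap _))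
         (∑-weighted (pick K) λ t (x , s) → pure (partial x (f ∘ times t K)) s))))

two-copies : ∀ x es f → ∑ (subs (x ∷ x ∷ es)) f ≡
  ∑ (subs es) f + 2 * ∑ (subs es) (f ∘ times 1 x) + ∑ (subs es) (f ∘ times 2 x)
two-copies x es f = begin
  _ ≡⟨ subs-∷ x (x ∷ es) f ⟩
  _ ≡⟨ cong₂ _+_ (subs-∷ x es f) (subs-∷ x es (f ∘ add x)) ⟩
  _ ≡⟨ lemma (∑ (subs es) f) (∑ (subs es) (f ∘ times 1 x)) (∑ (subs es) (f ∘ times 2 x)) ⟩
  _ ∎
  where lemma : ∀ a b c → a + b + (b + c) ≡ a + 2 * b + c
        lemma = solve-∀

four-copies : ∀ x es f → ∑ (subs (x ∷ x ∷ x ∷ x ∷ es)) f ≡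
  ∑ (subs es) f + 4 * ∑ (subs es) (f ∘ times 1 x) + 6 * ∑ (subs es) (f ∘ times 2 x)
  + 4 * ∑ (subs es) (f ∘ times 3 x) + ∑ (subs es) (f ∘ times 4 x)
four-copies x es f = begin
  _ ≡⟨ two-copies x (x ∷ x ∷ es) f ⟩
  _ ≡⟨ cong₂ _+_ (cong₂ _+_ (two-copies x es f) (cong (2 *_) (two-copies x es (f ∘ times 1 x))))
                 (two-copies x es (f ∘ times 2 x)) ⟩
  _ ≡⟨ lemma (T 0) (T 1) (T 2) (T 3) (T 4) ⟩
  _ ∎
  where
  T : ℕ → ℕ
  T t = ∑ (subs es) (f ∘ times t x)
  lemma : ∀ a b c d e → a + 2 * b + c + 2 * (b + 2 * c + d) + (c + 2 * d + e) ≡ a + 4 * b + 6 * c + 4 * d + e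
  lemma = solve-∀

six-copies : ∀ x es f → ∑ (subs (x ∷ x ∷ x ∷ x ∷ x ∷ x ∷ es)) f ≡
  ∑ (subs es) f + 6 * ∑ (subs es) (f ∘ times 1 x) + 15 * ∑ (subs es) (f ∘ times 2 x)
  + 20 * ∑ (subs es) (f ∘ times 3 x) + 15 * ∑ (subs es) (f ∘ times 4 x)
  + 6 * ∑ (subs es) (f ∘ times 5 x) + ∑ (subs es) (f ∘ times 6 x)
six-copies x es f = begin
  _ ≡⟨ two-copies x (x ∷ x ∷ x ∷ x ∷ es) f ⟩
  _ ≡⟨ cong₂ _+_ (cong₂ _+_ (four-copies x es f) (cong (2 *_) (four-copies x es (f ∘ times 1 x))))
                 (four-copies x es (f ∘ times 2 x)) ⟩
  _ ≡⟨ lemma (T 0) (T 1) (T 2) (T 3) (T 4) (T 5) (T 6) ⟩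
  _ ∎
  where
  T : ℕ → ℕ
  T t = ∑ (subs es) (f ∘ times t x)
  lemma : ∀ a b c d e g h → a + 4 * b + 6 * c + 4 * d + e + 2 * (b + 4 * c + 6 * d + 4 * e + g) + (c + 4 * d + 6 * e + 4 * g + h)
            ≡ a + 6 * b + 15 * c + 20 * d + 15 * e + 6 * g + h
  lemma = solve-∀

-- The identity `(1 + y)⁷ = 1 + y⁷ + 7 g(y)`. The binomial coefficients are built up through 2, 4
-- and 6 copies, so that each polynomial identity stays small.
seven-copies : ∀ x es f → ∑ (subs (x ∷ x ∷ x ∷ x ∷ x ∷ x ∷ x ∷ es)) f ≡
  ∑ (subs es) f + ∑ (subs es) (f ∘ times 7 x) + 7 * weighted (λ t → ∑ (subs es) (f ∘ times t x))
seven-copies x es f = begin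
  _ ≡⟨ subs-∷ x (x ∷ x ∷ x ∷ x ∷ x ∷ x ∷ es) f ⟩
  _ ≡⟨ cong₂ _+_ (six-copies x es f) (six-copies x es (f ∘ times 1 x)) ⟩
  _ ≡⟨ lemma (T 0) (T 1) (T 2) (T 3) (T 4) (T 5) (T 6) (T 7) ⟩
  _ ≡⟨ cong (λ u → T 0 + T 7 + 7 * u) (weighted-explicit T) ⟨
  _ ∎
  where
  T : ℕ → ℕ
  T t = ∑ (subs es) (f ∘ times t x)
  lemma : ∀ a b c d e g h i →
          a + 6 * b + 15 * c + 20 * d + 15 * e + 6 * g + h + (b + 6 * c + 15 * d + 20 * e + 15 * g + 6 * h + i)
            ≡ a + i + 7 * (1 * h + (3 * g + (5 * e + (5 * d + (3 * c + (1 * b + 0))))))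
  lemma = solve-∀

-- Each level contributes a factor `1 + y⁷ + 7 g(y)`; taking `7 g` at three or more levels gives a
-- multiple of `7³`, which goes into `r`.
expansion : ∀ K f → ∃ λ r → ∑ (subs (levels K)) f ≡ Z₀ K f + 7 * Z₁ K f + 49 * Z₂ K f + 343 * r
expansion zero    f = 0 , cong (λ a → a + 0) (lemma (f (0 , 0)))
  where lemma : ∀ a → a ≡ a + 0 + 0 + 0
        lemma = solve-∀
expansion (suc K) f = r , (begin
  ∑ (subs (levels (suc K))) f
    ≡⟨ seven-copies K (levels K) f ⟩
  _ ≡⟨ cong₂ (λ a b → a + b + 7 * weighted (λ t → ∑ (subs (levels K)) (f ∘ times t K)))
         (proj₂ (expansion K f)) (proj₂ (expansion K (f ∘ times 7 K))) ⟩
  Z₀ K f + 7 * Z₁ K f + 49 * Z₂ K f + 343 * ρ 0 + (Z₀ K f₇ + 7 * Z₁ K f₇ + 49 * Z₂ K f₇ + 343 * ρ 7)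
    + 7 * weighted (λ t → ∑ (subs (levels K)) (f ∘ times t K))
    ≡⟨ cong (λ u → Z₀ K f + 7 * Z₁ K f + 49 * Z₂ K f + 343 * ρ 0
                    + (Z₀ K f₇ + 7 * Z₁ K f₇ + 49 * Z₂ K f₇ + 343 * ρ 7) + 7 * u) expand ⟩
  Z₀ K f + 7 * Z₁ K f + 49 * Z₂ K f + 343 * ρ 0 + (Z₀ K f₇ + 7 * Z₁ K f₇ + 49 * Z₂ K f₇ + 343 * ρ 7)
    + 7 * (weighted a + 7 * weighted b + 49 * weighted c + 343 * weighted ρ)
    ≡⟨ collect (Z₀ K f) (Z₁ K f) (Z₂ K f) (ρ 0) (Z₀ K f₇) (Z₁ K f₇) (Z₂ K f₇) (ρ 7)
         (weighted a) (weighted b) (weighted c) (weighted ρ) ⟩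
  _ ≡⟨ cong (_+ 343 * r) (cong₂ _+_ (cong₂ _+_ (Z₀-suc K f) (cong (7 *_) (Z₁-suc K f))) (cong (49 *_) (Z₂-suc K f))) ⟨
  Z₀ (suc K) f + 7 * Z₁ (suc K) f + 49 * Z₂ (suc K) f + 343 * r ∎)
  where
  f₇ = f ∘ times 7 K
  ρ a b c : ℕ → ℕ
  ρ t = proj₁ (expansion K (f ∘ times t K))
  a t = Z₀ K (f ∘ times t K)
  b t = Z₁ K (f ∘ times t K)
  c t = Z₂ K (f ∘ times t K)
  -- `weighted c` makes `K` a third partial level, with coefficient `7 * 49`; the other terms come
  -- from earlier remainders.
  r = ρ 0 + ρ 7 + weighted c + 7 * weighted ρ
  expand : weighted (λ t → ∑ (subs (levels K)) (f ∘ times t K)) ≡ weighted a + 7 * weighted b + 49 * weighted c + 343 * weighted ρ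
  expand = begin
    _ ≡⟨ weighted-cong (λ t → proj₂ (expansion K (f ∘ times t K))) ⟩
    weighted (λ t → a t + 7 * b t + 49 * c t + 343 * ρ t)
      ≡⟨ weighted-+ (λ t → a t + 7 * b t + 49 * c t) (λ t → 343 * ρ t) ⟩
    _ ≡⟨ cong₂ _+_ (trans (weighted-+ (λ t → a t + 7 * b t) (λ t → 49 * c t))
            (cong₂ _+_ (trans (weighted-+ a (λ t → 7 * b t)) (cong (weighted a +_) (weighted-* 7 b))) (weighted-* 49 c)))
           (weighted-* 343 ρ) ⟩
    weighted a + 7 * weighted b + 49 * weighted c + 343 * weighted ρ ∎
  collect : ∀ z₀ z₁ z₂ r₀ y₀ y₁ y₂ r₇ a b c ρ →
    z₀ + 7 * z₁ + 49 * z₂ + 343 * r₀ + (y₀ + 7 * y₁ + 49 * y₂ + 343 * r₇) + 7 * (a + 7 * b + 49 * c + 343 * ρ)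
    ≡ z₀ + y₀ + 7 * (z₁ + (y₁ + a)) + 49 * (z₂ + (y₂ + b)) + 343 * (r₀ + r₇ + c + 7 * ρ)
  collect = solve-∀

-- Addable and removable ribbons

subs-bounds : ∀ K → All (λ (c , E) → c ≤ K × tri c ≤ E) (subs (downFrom K))
subs-bounds zero    = (z≤n , z≤n) ∷ []
subs-bounds (suc K) = All.++⁺ (All.map (λ (p , q) → m≤n⇒m≤1+n p , q) (subs-bounds K))
  (All.map⁺ (All.map (λ (p , q) → s≤s p , +-mono-≤ p q) (subs-bounds K)))

-- The last bound counts `x` as one more occupied level, which is legitimate since the subset avoids
-- `x`.
pick-bounds : ∀ K → All (λ (x , c , E) → x < K × c < K × tri c ≤ E × tri (suc c) ≤ x + E) (pick K)
pick-bounds zero    = []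
pick-bounds (suc K) = All.++⁺ (All.map (λ (l , p , q) → m≤n⇒m≤1+n l , m≤n⇒m≤1+n p , q) (pick-bounds K))
  (All.++⁺
    (All.map⁺ (All.map (λ {(x , c , E)} (l , p , q , r) → m≤n⇒m≤1+n l , s≤s p , +-mono-≤ (<⇒≤ p) q ,
                          subst (tri (2 + c) ≤_) (x∙yz≈y∙xz K x E) (+-mono-≤ p r)) (pick-bounds K)))
    (All.map⁺ (All.map (λ (p , q) → n<1+n K , s≤s p , q , +-mono-≤ p q) (subs-bounds K))))

pair-bounds : ∀ K → All (λ ((x , y) , c , E) → x < y × y < K × suc c < K × tri (suc c) ≤ x + E) (pair K)
pair-bounds zero    = []
pair-bounds (suc K) = All.++⁺ (All.map (λ (l , p , q , r) → l , m≤n⇒m≤1+n p , m≤n⇒m≤1+n q , r) (pair-bounds K))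
  (All.++⁺
    (All.map⁺ (All.map (λ {((x , y) , c , E)} (l , p , q , r) → l , m≤n⇒m≤1+n p , s≤s q ,
                          subst (tri (2 + c) ≤_) (x∙yz≈y∙xz K x E) (+-mono-≤ (<⇒≤ q) r)) (pair-bounds K)))
    (All.map⁺ (All.map (λ (l , p , q , r) → l , n<1+n K , s≤s p , r) (pick-bounds K))))

lt : ℕ → ℕ → ℕ
lt m       zero    = 0
lt zero    (suc n) = 1
lt (suc m) (suc n) = lt m n

lt-suc : ∀ m n → lt m (suc n) ≡ lt m n + δ m n
lt-suc zero    zero    = refl
lt-suc zero    (suc n) = refl
lt-suc (suc m) zero    = refl
lt-suc (suc m) (suc n) = lt-suc m n

lt-< : ∀ {m n} → m < n → lt m n ≡ 1
lt-< {zero}  (s≤s p) = refl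
lt-< {suc m} (s≤s p) = lt-< p

lt-≥ : ∀ {m n} → n ≤ m → lt m n ≡ 0
lt-≥ {n = zero}  p       = refl
lt-≥ {suc m} {suc n} (s≤s p) = lt-≥ p

lt-or : ∀ m n → lt m n + lt n (suc m) ≡ 1
lt-or m       zero    = refl
lt-or zero    (suc n) = cong suc (lt-≥ {n} {0} z≤n)
lt-or (suc m) (suc n) = lt-or m n

δ-sym : ∀ m n → δ m n ≡ δ n m
δ-sym zero    zero    = refl
δ-sym zero    (suc n) = refl
δ-sym (suc m) zero    = refl
δ-sym (suc m) (suc n) = δ-sym m n

δ-subst : ∀ m n (h : ℕ → ℕ) → δ m n * h n ≡ δ m n * h m
δ-subst m n h with m ≟ n
... | yes refl = refl
... | no m≢n rewrite δ-≢ m≢n = refl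

∑-δ : ∀ k n → ∑ (downFrom n) (λ x → δ x k) ≡ lt k n
∑-δ k zero    = refl
∑-δ k (suc n) = begin
  δ n k + ∑ (downFrom n) (λ x → δ x k) ≡⟨ cong₂ _+_ (δ-sym n k) (∑-δ k n) ⟩
  δ k n + lt k n                       ≡⟨ +-comm (δ k n) _ ⟩
  lt k n + δ k n                       ≡⟨ lt-suc k n ⟨
  lt k (suc n)                         ∎

∑-lt : ∀ {D K} → D ≤ K → ∑ (downFrom K) (λ y → lt y D) ≡ D
∑-lt {D} {K} D≤K = trans (go K) (m≥n⇒m⊓n≡n D≤K)
  where
  go : ∀ K → ∑ (downFrom K) (λ y → lt y D) ≡ K ⊓ D
  go zero    = refl
  go (suc K) with K <? D
  ... | yes K<D rewrite lt-< K<D | go K | m≤n⇒m⊓n≡m (<⇒≤ K<D) = sym (m≤n⇒m⊓n≡m K<D)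
  ... | no K≮D rewrite lt-≥ (≮⇒≥ K≮D) | go K | m≥n⇒m⊓n≡n (≮⇒≥ K≮D) = sym (m≥n⇒m⊓n≡n (m≤n⇒m≤1+n (≮⇒≥ K≮D)))

∑-δ-shift : ∀ d K → ∑ (downFrom K) (λ x → δ (x + suc d) K) ≡ lt d K
∑-δ-shift d K with d <? K
... | yes d<K = begin
  ∑ (downFrom K) (λ x → δ (x + suc d) K)
    ≡⟨ ∑-cong (downFrom K) (λ x → trans (cong (δ (x + suc d)) (sym (m∸n+n≡m d<K))) (δ-+ʳ (suc d) x (K ∸ suc d))) ⟩
  ∑ (downFrom K) (λ x → δ x (K ∸ suc d))
    ≡⟨ ∑-δ (K ∸ suc d) K ⟩
  lt (K ∸ suc d) K ≡⟨ lt-< (∸-monoʳ-< {K} {suc d} {0} (s≤s z≤n) d<K) ⟩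
  1                ≡⟨ lt-< d<K ⟨
  lt d K ∎
... | no d≮K = begin
  ∑ (downFrom K) (λ x → δ (x + suc d) K)
    ≡⟨ ∑-cong (downFrom K) (λ x → δ-≢ λ eq → d≮K (≤-trans (m≤n+m (suc d) x) (≤-reflexive eq))) ⟩
  ∑ (downFrom K) (λ _ → 0) ≡⟨ ∑-zero (downFrom K) ⟩
  0                        ≡⟨ lt-≥ (≮⇒≥ d≮K) ⟨
  lt d K ∎

-- Once `x` may be either taken in or left out, the subset is unrestricted and independent of `x`,
-- so the sum factors.
pick-either : ∀ K (k : ℕ → ℕ) (φ : State → ℕ) →
  ∑ (pick K) (λ (x , s) → k x * (φ s + φ (add x s))) ≡ ∑ (downFrom K) k * ∑ (subs (downFrom K)) φ
pick-either zero    k φ = refl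
pick-either (suc K) k φ = begin
  _ ≡⟨ ∑-pick K (λ (x , s) → k x * (φ s + φ (add x s))) ⟩
  _ ≡⟨ cong₂ _+_ (pick-either K k φ) (cong₂ _+_
         (trans (∑-cong (pick K) (λ (x , s) → cong (λ u → k x * (φ (add K s) + φ u)) (add-comm x K s))) (pick-either K k (φ ∘ add K)))
         (trans (∑-* (subs (downFrom K)) (k K) _) (cong (k K *_) (∑-+ (subs (downFrom K)) φ (φ ∘ add K))))) ⟩
  σ * a + (σ * b + k K * (a + b)) ≡⟨ lemma σ a b (k K) ⟩
  (k K + σ) * (a + b)             ≡⟨ cong ((k K + σ) *_) (subs-∷ K (downFrom K) φ) ⟨
  (k K + σ) * ∑ (subs (downFrom (suc K))) φ ∎
  where
  σ = ∑ (downFrom K) k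
  a = ∑ (subs (downFrom K)) φ
  b = ∑ (subs (downFrom K)) (φ ∘ add K)
  lemma : ∀ σ a b k → σ * a + (σ * b + k * (a + b)) ≡ (k + σ) * (a + b)
  lemma = solve-∀

pick-size : ∀ K (φ : State → ℕ) → ∑ (pick K) (λ (x , s) → φ (add x s)) ≡ ∑ (subs (downFrom K)) (λ s → proj₁ s * φ s)
pick-size zero    φ = refl
pick-size (suc K) φ = begin
  _ ≡⟨ ∑-pick K (λ (x , s) → φ (add x s)) ⟩
  _ ≡⟨ cong₂ _+_ (pick-size K φ) (cong (_+ ∑ (subs (downFrom K)) (φ ∘ add K))
         (trans (∑-cong (pick K) (λ (x , s) → cong φ (add-comm x K s))) (pick-size K (φ ∘ add K)))) ⟩
  ∑ S (λ s → proj₁ s * φ s) + (∑ S (λ s → proj₁ s * φ (add K s)) + ∑ S (φ ∘ add K))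
    ≡⟨ cong (∑ S (λ s → proj₁ s * φ s) +_) (trans (+-comm _ (∑ S (φ ∘ add K))) (sym (∑-+ S (φ ∘ add K) _))) ⟩
  ∑ S (λ s → proj₁ s * φ s) + ∑ S (λ s → suc (proj₁ s) * φ (add K s))
    ≡⟨ subs-∷ K (downFrom K) (λ s → proj₁ s * φ s) ⟨
  _ ∎
  where S = subs (downFrom K)

-- Summing over both occupations of `y = x + suc d` forgets `y`; all that remains is that this level
-- exists below `K`.
pair-upper-either : ∀ d K (g : ℕ → State → ℕ) →
  ∑ (pair K) (λ ((x , y) , s) → δ (x + suc d) y * (g x s + g x (add y s)))
  ≡ ∑ (pick K) (λ (x , s) → lt (x + suc d) K * g x s)
pair-upper-either d zero    g = refl
pair-upper-either d (suc K) g = begin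
  _ ≡⟨ ∑-pair K (λ ((x , y) , s) → δ (x + suc d) y * (g x s + g x (add y s))) ⟩
  _ ≡⟨ cong₂ _+_ (pair-upper-either d K g) (cong₂ _+_
         (trans (∑-cong (pair K) (λ ((x , y) , s) → cong (λ u → δ (x + suc d) y * (g x (add K s) + g x u)) (add-comm y K s)))
                (pair-upper-either d K (λ x → g x ∘ add K)))
         (trans (∑-cong (pick K) (λ (x , s) → *-distribˡ-+ (δ (x + suc d) K) (g x s) (g x (add K s))))
                (∑-+ (pick K) (λ (x , s) → δ (x + suc d) K * g x s) (λ (x , s) → δ (x + suc d) K * g x (add K s))))) ⟩
  a + (b + (a′ + b′)) ≡⟨ lemma a b a′ b′ ⟩
  -- The `0` is the case where `K` itself is the lower level: `K + suc d` is out of range.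
  a + a′ + (b + b′ + 0)
    ≡⟨ cong₂ _+_ (merge g) (cong₂ _+_ (merge (λ x → g x ∘ add K))
         (trans (∑-cong (subs (downFrom K)) λ s → cong (_* g K s)
                  (lt-≥ {K + suc d} (subst (suc K ≤_) (sym (+-suc K d)) (s≤s (m≤m+n K d)))))
                (∑-zero (subs (downFrom K))))) ⟨
  _ ≡⟨ ∑-pick K (λ (x , s) → lt (x + suc d) (suc K) * g x s) ⟨
  _ ∎
  where
  a = ∑ (pick K) (λ (x , s) → lt (x + suc d) K * g x s)
  b = ∑ (pick K) (λ (x , s) → lt (x + suc d) K * g x (add K s))
  a′ = ∑ (pick K) (λ (x , s) → δ (x + suc d) K * g x s)
  b′ = ∑ (pick K) (λ (x , s) → δ (x + suc d) K * g x (add K s))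
  lemma : ∀ a b a′ b′ → a + (b + (a′ + b′)) ≡ a + a′ + (b + b′ + 0)
  lemma = solve-∀
  merge : ∀ (h : ℕ → State → ℕ) → ∑ (pick K) (λ (x , s) → lt (x + suc d) (suc K) * h x s)
        ≡ ∑ (pick K) (λ (x , s) → lt (x + suc d) K * h x s) + ∑ (pick K) (λ (x , s) → δ (x + suc d) K * h x s)
  merge h = trans (∑-cong (pick K) (λ (x , s) → trans (cong (_* h x s) (lt-suc (x + suc d) K)) (*-distribʳ-+ (h x s) (lt (x + suc d) K) _)))
                  (∑-+ (pick K) (λ (x , s) → lt (x + suc d) K * h x s) (λ (x , s) → δ (x + suc d) K * h x s))

-- Here the lower level `x` is forgotten, leaving the condition that `y − suc d` is not negative.
pair-lower-either : ∀ d K (g : ℕ → State → ℕ) →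
  ∑ (pair K) (λ ((x , y) , s) → δ (x + suc d) y * (g y s + g y (add x s)))
  ≡ ∑ (pick K) (λ (y , s) → lt d y * g y s)
pair-lower-either d zero    g = refl
pair-lower-either d (suc K) g = begin
  _ ≡⟨ ∑-pair K (λ ((x , y) , s) → δ (x + suc d) y * (g y s + g y (add x s))) ⟩
  _ ≡⟨ cong₂ _+_ (pair-lower-either d K g) (cong₂ _+_
         (trans (∑-cong (pair K) (λ ((x , y) , s) → cong (λ u → δ (x + suc d) y * (g y (add K s) + g y u)) (add-comm x K s)))
                (pair-lower-either d K (λ y → g y ∘ add K)))
         (trans (pick-either K (λ x → δ (x + suc d) K) (g K))
                (trans (cong (_* ∑ (subs (downFrom K)) (g K)) (∑-δ-shift d K)) (sym (∑-* (subs (downFrom K)) (lt d K) (g K)))))) ⟩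
  _ ≡⟨ ∑-pick K (λ (y , s) → lt d y * g y s) ⟨
  _ ∎

-- For `K = L + L` the subsets of size `L` are the Maya diagrams of the partitions `λ` inside an
-- `L × L` box, and `E = tri L + |λ|`.
subsetSum : ℕ → ℕ → (ℕ → ℕ) → ℕ
subsetSum K L F = ∑ (subs (downFrom K)) λ (c , E) → δ c L * F E

-- Sums over the subsets of size L from which x may be moved up to the free place x + D; F is evaluated at the energy
-- before the move.
moveSum : ℕ → ℕ → ℕ → (ℕ → ℕ) → ℕ
moveSum K L D F = ∑ (pair K) λ ((x , y) , c , E) → δ (x + D) y * (δ (suc c) L * F (x + E))

moveSum-cong : ∀ K L D {F G} → (∀ m → F m ≡ G m) → moveSum K L D F ≡ moveSum K L D G
moveSum-cong K L D h = ∑-cong (pair K) λ ((x , y) , c , E) → cong (λ u → δ (x + D) y * (δ (suc c) L * u)) (h _)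

-- Energies below `tri L` are unattainable by `L` distinct levels; the others in the support are so
-- close to `tri L` that moves by `D` feel neither end of the range as an obstruction.
NearVacuum : ℕ → ℕ → (ℕ → ℕ) → Set
NearVacuum L D F = ∀ m → F m ≡ 0 ⊎ (m < tri L ⊎ D + m < L + tri L)

-- A partition has `D` more addable than removable `D`-ribbons. In a subset of size `L`, every `x`
-- can either move up by `D` or has `x + D` occupied. Likewise every `y ≥ D` can either move down or
-- has `y − D` occupied. The occupied pairs `W` agree, and the levels below `D`, all occupied, make
-- up the difference. A removable ribbon is recorded by the diagram after its removal, hence the
-- shift of `F` by `D`.
ribbons : ∀ L d F → suc d ≤ L + L → NearVacuum L (suc d) F →
  moveSum (L + L) L (suc d) F ≡ moveSum (L + L) L (suc d) (F ∘ (suc d +_)) + suc d * subsetSum (L + L) L F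
ribbons L d F D≤K near = +-cancelʳ-≡ W _ _ (begin
  moveSum K L D F + W
    ≡⟨ trans
         (∑-cong (pair K) (λ ((x , y) , s) → trans
            (cong (λ u → δ (x + D) y * (φ (add x s) + φ u)) (add-comm x y s))
            (*-distribˡ-+ (δ (x + D) y) (φ (add x s)) _)))
         (∑-+ (pair K) (λ ((x , y) , s) → δ (x + D) y * φ (add x s)) both) ⟨
  _ ≡⟨ pair-upper-either d K (λ x → φ ∘ add x) ⟩
  ∑ (pick K) (λ (x , s) → lt (x + D) K * φ (add x s))
    ≡⟨ ∑-cong-All (pick-bounds K) room-above ⟩
  ∑ (pick K) (λ (x , s) → φ (add x s))
    ≡⟨ ∑-cong (pick K) (λ (x , s) → trans (sym (*-identityˡ _)) (trans (cong (_* φ (add x s)) (sym (lt-or d x)))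
          (*-distribʳ-+ (φ (add x s)) (lt d x) _))) ⟩
  ∑ (pick K) (λ (x , s) → lt d x * φ (add x s) + lt x D * φ (add x s))
    ≡⟨ ∑-+ (pick K) (λ (x , s) → lt d x * φ (add x s)) (λ (x , s) → lt x D * φ (add x s)) ⟩
  ∑ (pick K) (λ (x , s) → lt d x * φ (add x s)) + ∑ (pick K) (λ (x , s) → lt x D * φ (add x s))
    ≡⟨ cong₂ _+_ (sym (pair-lower-either d K (λ y → φ ∘ add y))) (sym (∑-cong-All (pick-bounds K) full-below)) ⟩
  ∑ (pair K) (λ ((x , y) , s) → δ (x + D) y * (φ (add y s) + φ (add y (add x s))))
  + ∑ (pick K) (λ (x , s) → lt x D * (φ s + φ (add x s)))
    ≡⟨ cong₂ _+_ (trans (∑-cong (pair K) split)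
           (∑-+ (pair K) (λ ((x , y) , c , E) → δ (x + D) y * (δ (suc c) L * F (D + (x + E)))) both))
         (trans (pick-either K (λ x → lt x D) φ) (cong (_* subsetSum K L F) (∑-lt D≤K))) ⟩
  moveSum K L D (F ∘ (D +_)) + W + D * subsetSum K L F
    ≡⟨ lemma (moveSum K L D (F ∘ (D +_))) W _ ⟩
  moveSum K L D (F ∘ (D +_)) + D * subsetSum K L F + W ∎)
  where
  K = L + L
  D = suc d
  φ : State → ℕ
  φ (c , E) = δ c L * F E
  both : (ℕ × ℕ) × State → ℕ
  both ((x , y) , s) = δ (x + D) y * φ (add y (add x s))
  W = ∑ (pair K) both
  lemma : ∀ a b c → a + b + c ≡ a + c + b
  lemma = solve-∀
  split : ∀ p → let ((x , y) , c , E) = p in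
    δ (x + D) y * (φ (add y (c , E)) + φ (add y (add x (c , E))))
    ≡ δ (x + D) y * (δ (suc c) L * F (D + (x + E))) + δ (x + D) y * φ (add y (add x (c , E)))
  split ((x , y) , c , E) = trans (*-distribˡ-+ (δ (x + D) y) (φ (add y (c , E))) (φ (add y (add x (c , E)))))
    (cong (_+ δ (x + D) y * φ (add y (add x (c , E))))
      (trans (δ-subst (x + D) y (λ u → δ (suc c) L * F (u + E))) (cong (λ u → δ (x + D) y * (δ (suc c) L * F u)) (shuffle x D E))))
    where shuffle : ∀ x D E → x + D + E ≡ D + (x + E)
          shuffle = solve-∀
  -- The other `c = L − 1` levels total at least `tri c`, so an energy near the vacuum forces
  -- `x + D < L + c < K`.
  room-above : ∀ p → let (x , c , E) = p in x < K × c < K × tri c ≤ E × tri (suc c) ≤ x + E →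
    lt (x + D) K * φ (add x (c , E)) ≡ φ (add x (c , E))
  room-above (x , c , E) (_ , _ , tri≤ , tri-suc≤) with suc c ≟ L
  ... | no c≢ rewrite δ-≢ c≢ = *-zeroʳ (lt (x + D) K)
  ... | yes refl with near (x + E)
  ...   | inj₁ F≡0 rewrite F≡0 | *-zeroʳ (δ (suc c) (suc c)) = *-zeroʳ (lt (x + D) K)
  ...   | inj₂ (inj₁ q) = contradiction tri-suc≤ (<⇒≱ q)
  ...   | inj₂ (inj₂ q) = trans (cong (_* φ (add x (c , E))) (lt-< x+D<K)) (*-identityˡ _)
    where
    x+D<K : x + D < suc c + suc c
    x+D<K = <-≤-trans (+-cancelʳ-< (tri c) (x + D) (suc c + c)
      (≤-<-trans (≤-trans (+-monoʳ-≤ (x + D) tri≤) (≤-reflexive (shuffle x D E)))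
         (subst (D + (x + E) <_) (sym (+-assoc (suc c) c (tri c))) q)))
      (+-monoʳ-≤ (suc c) (n≤1+n c))
      where shuffle : ∀ x D E → x + D + E ≡ D + (x + E)
            shuffle = solve-∀
  -- A free level `x < D` would complete the `L` occupied ones to `L + 1` distinct levels of total
  -- below `D + E < tri (suc L)`, which is impossible.
  full-below : ∀ p → let (x , c , E) = p in x < K × c < K × tri c ≤ E × tri (suc c) ≤ x + E →
    lt x D * (φ (c , E) + φ (add x (c , E))) ≡ lt x D * φ (add x (c , E))
  full-below (x , c , E) (_ , _ , tri≤ , tri-suc≤) with x <? D
  ... | no x≮D rewrite lt-≥ (≮⇒≥ x≮D) = refl
  ... | yes x<D with c ≟ L
  ...   | no c≢ rewrite δ-≢ c≢ = refl
  ...   | yes refl with near E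
  ...     | inj₁ F≡0 rewrite F≡0 | *-zeroʳ (δ c c) = refl
  ...     | inj₂ (inj₁ q) = contradiction tri≤ (<⇒≱ q)
  ...     | inj₂ (inj₂ q) = contradiction tri-suc≤ (<⇒≱ (<-trans (+-monoˡ-< E x<D) q))

-- Iterates `ribbons`: each round raises the shift by `D` and releases one subset sum. Shifting `F`
-- keeps it near the vacuum.
telescope : ∀ L d F → suc d ≤ L + L → NearVacuum L (suc d) F → ∀ B →
  moveSum (L + L) L (suc d) F ≡ ∑ (downFrom B) (λ k → suc d * subsetSum (L + L) L (F ∘ (k * suc d +_)))
                                + moveSum (L + L) L (suc d) (F ∘ (B * suc d +_))
telescope L d F D≤K near zero    = refl
telescope L d F D≤K near (suc B) = begin
  moveSum K L D F
    ≡⟨ telescope L d F D≤K near B ⟩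
  Σ′ + moveSum K L D (F ∘ (B * D +_))
    ≡⟨ cong (Σ′ +_) (ribbons L d (F ∘ (B * D +_)) D≤K near′) ⟩
  Σ′ + (moveSum K L D (F ∘ (B * D +_) ∘ (D +_)) + t)
    ≡⟨ cong (λ u → Σ′ + (u + t)) (moveSum-cong K L D (λ m → cong F (shuffle (B * D) D m))) ⟩
  Σ′ + (moveSum K L D (F ∘ (suc B * D +_)) + t)
    ≡⟨ lemma Σ′ _ t ⟩
  t + Σ′ + moveSum K L D (F ∘ (suc B * D +_)) ∎
  where
  K = L + L
  D = suc d
  Σ′ = ∑ (downFrom B) (λ k → D * subsetSum K L (F ∘ (k * D +_)))
  t = D * subsetSum K L (F ∘ (B * D +_))
  lemma : ∀ a b c → a + (b + c) ≡ c + a + b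
  lemma = solve-∀
  shuffle : ∀ a b m → a + (b + m) ≡ b + a + m
  shuffle = solve-∀
  near′ : NearVacuum L D (F ∘ (B * D +_))
  near′ m with near (B * D + m)
  ... | inj₁ z        = inj₁ z
  ... | inj₂ (inj₁ p) = inj₂ (inj₁ (≤-<-trans (m≤n+m m (B * D)) p))
  ... | inj₂ (inj₂ p) = inj₂ (inj₂ (≤-<-trans (+-monoʳ-≤ D (m≤n+m m (B * D))) p))

-- The energy before a move is that of `L` distinct levels, hence at least `tri L`. This ends the
-- telescoping.
moveSum-zero : ∀ K L D F → (∀ m → tri L ≤ m → F m ≡ 0) → moveSum K L D F ≡ 0
moveSum-zero K L D F h = trans (∑-cong-All (pair-bounds K) vanish) (∑-zero (pair K))
  where
  vanish : ∀ p → let ((x , y) , c , E) = p in x < y × y < K × suc c < K × tri (suc c) ≤ x + E →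
    δ (x + D) y * (δ (suc c) L * F (x + E)) ≡ 0
  vanish ((x , y) , c , E) (_ , _ , _ , q) with suc c ≟ L
  ... | no c≢ rewrite δ-≢ c≢ = *-zeroʳ (δ (x + D) y)
  ... | yes refl rewrite h (x + E) q | *-zeroʳ (δ (suc c) (suc c)) = *-zeroʳ (δ (x + D) y)

-- The weighted divisor sum

downFrom-bounded : ∀ n → All (_< n) (downFrom n)
downFrom-bounded zero    = []
downFrom-bounded (suc n) = n<1+n n ∷ All.map m≤n⇒m≤1+n (downFrom-bounded n)

∑-single : ∀ {n a} (f : ℕ → ℕ) → a < n → (∀ x → x < n → x ≢ a → f x ≡ 0) → ∑ (downFrom n) f ≡ f a
∑-single {n} {a} f a<n h = begin
  ∑ (downFrom n) f
    ≡⟨ ∑-cong-All (downFrom-bounded n) only ⟩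
  ∑ (downFrom n) (λ x → f a * δ x a)
    ≡⟨ trans (∑-* (downFrom n) (f a) _) (cong (f a *_) (trans (∑-δ a n) (lt-< a<n))) ⟩
  f a * 1 ≡⟨ *-identityʳ (f a) ⟩
  f a ∎
  where
  only : ∀ x → x < n → f x ≡ f a * δ x a
  only x x<n with x ≟ a
  ... | yes refl = sym (trans (cong (f x *_) (δ-refl x)) (*-identityʳ (f x)))
  ... | no x≢a   = trans (h x x<n x≢a) (sym (trans (cong (f a *_) (δ-≢ x≢a)) (*-zeroʳ (f a))))

∑-shift : ∀ n (g : ℕ → ℕ) → ∑ (downFrom (suc n)) g ≡ ∑ (downFrom n) (g ∘ suc) + g 0
∑-shift zero    g = +-identityʳ (g 0)
∑-shift (suc n) g = trans (cong (g (suc n) +_) (∑-shift n g)) (sym (+-assoc (g (suc n)) _ (g 0)))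

∑-blocks : ∀ B (h : ℕ → ℕ) → ∑ (downFrom (B * 7)) h ≡ ∑ (downFrom B) λ k → ∑ (downFrom 7) λ t → h (t + k * 7)
∑-blocks zero    h = refl
∑-blocks (suc B) h = trans
  (lemma (h (6 + B * 7)) (h (5 + B * 7)) (h (4 + B * 7)) (h (3 + B * 7)) (h (2 + B * 7)) (h (1 + B * 7)) (h (B * 7))
         (∑ (downFrom (B * 7)) h))
  (cong (∑ (downFrom 7) (λ t → h (t + B * 7)) +_) (∑-blocks B h))
  where lemma : ∀ a b c d e f g s → a + (b + (c + (d + (e + (f + (g + s)))))) ≡ a + (b + (c + (d + (e + (f + (g + 0)))))) + s
        lemma = solve-∀

∑-∣ : ∀ {A : Set} {k} (xs : List A) f → (∀ x → k ∣ f x) → k ∣ ∑ xs f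
∑-∣ []       f h = _ ∣0
∑-∣ (x ∷ xs) f h = ∣m∣n⇒∣m+n (h x) (∑-∣ xs f h)

opaque
  unfolding weighted

  weighted-def : ∀ f → weighted f ≡ ∑ (downFrom 7) λ t → w t * f t
  weighted-def f = refl

weighted-cong⁺ : ∀ {f g : ℕ → ℕ} → (∀ t → 0 < t → t < 7 → f t ≡ g t) → weighted f ≡ weighted g
weighted-cong⁺ {f} {g} h = begin
  weighted f ≡⟨ weighted-def f ⟩
  _          ≡⟨ ∑-cong-All (downFrom-bounded 7) termwise ⟩
  _          ≡⟨ weighted-def g ⟨
  weighted g ∎
  where
  termwise : ∀ t → t < 7 → w t * f t ≡ w t * g t
  termwise zero    _   = refl
  termwise (suc t) t<7 = cong (w (suc t) *_) (h (suc t) (s≤s z≤n) t<7)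

weighted-zero : weighted (λ _ → 0) ≡ 0
weighted-zero = weighted-* 0 (λ _ → 0)

weighted-single : ∀ {a} (f : ℕ → ℕ) → a < 7 → (∀ t → 0 < t → t < 7 → t ≢ a → f t ≡ 0) → weighted f ≡ w a * f a
weighted-single {a} f a<7 h = trans (weighted-def f) (∑-single (λ t → w t * f t) a<7 vanish)
  where
  vanish : ∀ t → t < 7 → t ≢ a → w t * f t ≡ 0
  vanish zero    _   _   = refl
  vanish (suc t) t<7 t≢a = trans (cong (w (suc t) *_) (h (suc t) (s≤s z≤n) t<7 t≢a)) (*-zeroʳ (w (suc t)))

-- Since `w` is symmetric, this is `(C(7,r)/7)²` for `r = e % 7`, and 0 if `7 ∣ e`. The two factors
-- belong to the two partial levels.
W : ℕ → ℕ
W e = w (e % 7) * w (7 ∸ e % 7)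

Nonresidue : ℕ → Set
Nonresidue r = r ≡ 3 ⊎ r ≡ 5 ⊎ r ≡ 6

-- Modulo 7, W e ≡ e⁻² ≡ e⁴ for e prime to 7, so the sum is ≡ e D (e³ + D³), and e³, D³ are opposite signs
-- when e D is a nonresidue.
W-symmetrised-residues : ∀ (r s : Fin 7) → Nonresidue ((toℕ r * toℕ s) % 7) →
  7 ∣ w (toℕ r) * w (7 ∸ toℕ r) * toℕ s + w (toℕ s) * w (7 ∸ toℕ s) * toℕ r
W-symmetrised-residues = toWitness {a? = all? λ r → all? λ s → nonresidue? ((toℕ r * toℕ s) % 7) →-dec
  (7 ∣? (w (toℕ r) * w (7 ∸ toℕ r) * toℕ s + w (toℕ s) * w (7 ∸ toℕ s) * toℕ r))} _
  where
  nonresidue? : ∀ r → Dec (Nonresidue r)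
  nonresidue? r = r ≟ 3 ⊎-dec (r ≟ 5 ⊎-dec r ≟ 6)

W-symmetrised : ∀ e D → Nonresidue ((e * D) % 7) → 7 ∣ W e * D + W D * e
W-symmetrised e D n = subst (7 ∣_) (sym regroup) (∣m∣n⇒∣m+n base (m∣m*n (W e * (D / 7) + W D * (e / 7))))
  where
  r = e % 7
  s = D % 7
  base : 7 ∣ W e * s + W D * r
  base = subst₂ (λ r s → 7 ∣ w r * w (7 ∸ r) * s + w s * w (7 ∸ s) * r) (toℕ-fromℕ< (m%n<n e 7)) (toℕ-fromℕ< (m%n<n D 7))
    (W-symmetrised-residues (fromℕ< (m%n<n e 7)) (fromℕ< (m%n<n D 7))
      (subst Nonresidue (trans (%-distribˡ-* e D 7)
         (cong₂ (λ r s → (r * s) % 7) (sym (toℕ-fromℕ< (m%n<n e 7))) (sym (toℕ-fromℕ< (m%n<n D 7))))) n))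
  regroup : W e * D + W D * e ≡ W e * s + W D * r + 7 * (W e * (D / 7) + W D * (e / 7))
  regroup = begin
    W e * D + W D * e
      ≡⟨ cong₂ (λ d u → W e * d + W D * u) (m≡m%n+[m/n]*n D 7) (m≡m%n+[m/n]*n e 7) ⟩
    W e * (s + D / 7 * 7) + W D * (r + e / 7 * 7)
      ≡⟨ lemma (W e) s (D / 7) (W D) r (e / 7) ⟩
    _ ∎
    where lemma : ∀ a s d b r u → a * (s + d * 7) + b * (r + u * 7) ≡ a * s + b * r + 7 * (a * d + b * u)
          lemma = solve-∀

W-block : ∀ {t} k → t < 7 → W (t + k * 7) ≡ w t * w (7 ∸ t)
W-block {t} k t<7 = cong (λ r → w r * w (7 ∸ r)) (trans ([m+kn]%n≡m%n t k 7) (m<n⇒m%n≡m t<7))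

δ-≢7 : ∀ {a} b c → ¬ (7 ∣ a) → δ (a + 7 * c) (7 * b) ≡ 0
δ-≢7 {a} b c 7∤a = δ-≢ λ eq → 7∤a (∣m+n∣m⇒∣n (subst (7 ∣_) (trans (sym eq) (+-comm a (7 * c))) (m∣m*n b)) (m∣m*n c))

<7⇒∤ : ∀ {t} → 0 < t → t < 7 → ¬ (7 ∣ t)
<7⇒∤ {suc t} _ t<7 7∣t = <⇒≱ t<7 (∣⇒≤ 7∣t)

-- The sum lies strictly between 0 and 14, so 7 is the only multiple of 7 it could be.
complement-∤ : ∀ {t u} → 0 < t → t < 7 → u < 7 → t ≢ 7 ∸ u → ¬ (7 ∣ u + t)
complement-∤ {t} {u} 0<t t<7 u<7 t≢ 7∣ = t≢ (begin
  t             ≡⟨ m+n∸m≡n u t ⟨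
  u + t ∸ u     ≡⟨ cong (_∸ u) (sum≡7 7∣) ⟩
  7 ∸ u         ∎)
  where
  sum≡7 : 7 ∣ u + t → u + t ≡ 7
  sum≡7 (divides 0 eq)             = contradiction (m+n≡0⇒n≡0 u eq) (m<n⇒n≢0 0<t)
  sum≡7 (divides 1 eq)             = eq
  sum≡7 (divides (suc (suc q)) eq) = contradiction (≤-trans (m≤m+n 14 (q * 7)) (≤-reflexive (sym eq))) (<⇒≱ (+-mono-< u<7 t<7))

-- Evaluation of the expansion when `N` is a nonresidue modulo 7

module _ {N L B : ℕ} (N-nonresidue : Nonresidue (N % 7)) (N<L : N < L) (range : suc (L + L) ≡ B * 7) where

  K N′ : ℕ
  K = L + L
  N′ = 7 * tri L + N

  7∤N : ¬ (7 ∣ N)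
  7∤N 7∣N with subst Nonresidue (n∣m⇒m%n≡0 N 7 7∣N) N-nonresidue
  ... | inj₁ ()
  ... | inj₂ (inj₁ ())
  ... | inj₂ (inj₂ ())

  Z₀-vanishes : Z₀ K (mayaTest L N) ≡ 0
  Z₀-vanishes = trans (∑-cong (subs (downFrom K)) (λ (c , E) → trans
    (cong (δ (7 * c) (7 * L) *_) (δ-≢ λ eq → 7∤N (∣m+n∣m⇒∣n (subst (7 ∣_) eq (m∣m*n E)) (m∣m*n (tri L)))))
    (*-zeroʳ (δ (7 * c) (7 * L))))) (∑-zero (subs (downFrom K)))

  Z₁-vanishes : Z₁ K (mayaTest L N) ≡ 0
  Z₁-vanishes = trans (∑-cong (pick K) (λ (x , c , E) → trans
    (weighted-cong⁺ λ t 0<t t<7 → trans (cong (mayaTest L N) (times-≡ t x (7 * c) (7 * E)))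
       (cong (_* δ (t * x + 7 * E) N′) (δ-≢7 {t} L c (<7⇒∤ 0<t t<7))))
    weighted-zero)) (∑-zero (pick K))

  -- The background `m` has `x` full and `x + D` empty; moving `t` of the seven particles from `x`
  -- to `x + D` adds `t * D` to its energy `7 * m`.
  energyTest : ℕ → ℕ → ℕ → ℕ
  energyTest t D m = δ (7 * m + t * D) N′

  -- With `t` particles at `x` and `u` at `y`, the charge condition modulo 7 leaves only
  -- `t = 7 ∸ u`; what remains of it is `suc c = L`, the size of the background with `x` filled.
  pair-test : ∀ x y c E → pure (partial x (partial y (mayaTest L N))) (c , E) ≡
    weighted λ u → w (7 ∸ u) * (δ (suc c) L * δ (u * y + ((7 ∸ u) * x + 7 * E)) N′)
  pair-test x y c E = trans (weighted-swap _) (weighted-cong⁺ λ u 0<u u<7 → trans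
    (weighted-cong λ t → cong (mayaTest L N)
      (trans (cong (times u y) (times-≡ t x (7 * c) (7 * E))) (times-≡ u y (t + 7 * c) (t * x + 7 * E))))
    (trans
      (weighted-single {7 ∸ u} (λ t → δ (u + (t + 7 * c)) (7 * L) * δ (u * y + (t * x + 7 * E)) N′)
        (∸-monoʳ-< {7} {u} {0} 0<u (<⇒≤ u<7))
        λ t 0<t t<7 t≢ → cong (_* δ (u * y + (t * x + 7 * E)) N′)
          (trans (cong (λ v → δ v (7 * L)) (sym (+-assoc u t (7 * c)))) (δ-≢7 {u + t} L c (complement-∤ 0<t t<7 u<7 t≢))))
      (cong (λ v → w (7 ∸ u) * (v * δ (u * y + ((7 ∸ u) * x + 7 * E)) N′)) (begin
        δ (u + (7 ∸ u + 7 * c)) (7 * L)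
          ≡⟨ cong (λ v → δ v (7 * L)) (trans (sym (+-assoc u (7 ∸ u) _)) (cong (_+ 7 * c) (m+[n∸m]≡n (<⇒≤ u<7)))) ⟩
        δ (7 + 7 * c) (7 * L) ≡⟨ cong (λ v → δ v (7 * L)) (*-suc 7 c) ⟨
        δ (7 * suc c) (7 * L) ≡⟨ δ-*ˡ 6 (suc c) L ⟩
        δ (suc c) L ∎))))

  split-distance : ∀ {x y} (A : ℕ → ℕ) → x < y → y < K → A y ≡ ∑ (downFrom K) λ d → δ (x + suc d) y * A (x + suc d)
  split-distance {x} {y} A x<y y<K = sym (begin
    ∑ (downFrom K) (λ d → δ (x + suc d) y * A (x + suc d))
      ≡⟨ ∑-cong (downFrom K) (λ d → trans (sym (δ-subst (x + suc d) y A)) (*-comm _ (A y))) ⟩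
    ∑ (downFrom K) (λ d → A y * δ (x + suc d) y)
      ≡⟨ ∑-* (downFrom K) (A y) (λ d → δ (x + suc d) y) ⟩
    A y * ∑ (downFrom K) (λ d → δ (x + suc d) y)
      ≡⟨ cong (A y *_) (∑-cong (downFrom K) λ d → trans (cong (δ (x + suc d)) (sym y≡)) (δ-+ˡ x (suc d) (suc k))) ⟩
    A y * ∑ (downFrom K) (λ d → δ d k)
      ≡⟨ cong (A y *_) (trans (∑-δ k K) (lt-< k<K)) ⟩
    A y * 1 ≡⟨ *-identityʳ (A y) ⟩
    A y ∎)
    where
    k = y ∸ suc x
    y≡ : x + suc k ≡ y
    y≡ = trans (+-suc x k) (m+[n∸m]≡n x<y)
    k<K : k < K
    k<K = ≤-<-trans (m∸n≤m y (suc x)) y<K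

  pair-energy : ∀ x D E u → u ≤ 7 → u * (x + D) + ((7 ∸ u) * x + 7 * E) ≡ 7 * (x + E) + u * D
  pair-energy x D E u u≤7 = trans (lemma u (7 ∸ u) x D E)
    (trans (cong (λ v → v * x + 7 * E + u * D) (m+[n∸m]≡n u≤7)) (lemma′ x E (u * D)))
    where
    lemma : ∀ u v x D E → u * (x + D) + (v * x + 7 * E) ≡ (u + v) * x + 7 * E + u * D
    lemma = solve-∀
    lemma′ : ∀ x E d → 7 * x + 7 * E + d ≡ 7 * (x + E) + d
    lemma′ = solve-∀

  Z₂-moves : Z₂ K (mayaTest L N) ≡ ∑ (downFrom K) λ d → weighted λ u → w (7 ∸ u) * moveSum K L (suc d) (energyTest u (suc d))
  Z₂-moves = begin
    Z₂ K (mayaTest L N)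
      ≡⟨ ∑-cong-All (pair-bounds K) (λ ((x , y) , c , E) (x<y , y<K , _) →
           trans (pair-test x y c E) (split-distance (A x c E) x<y y<K)) ⟩
    ∑ (pair K) (λ ((x , y) , c , E) → ∑ (downFrom K) λ d → δ (x + suc d) y * A x c E (x + suc d))
      ≡⟨ ∑-swap (pair K) (downFrom K) (λ ((x , y) , c , E) d → δ (x + suc d) y * A x c E (x + suc d)) ⟩
    ∑ (downFrom K) (λ d → ∑ (pair K) λ ((x , y) , c , E) → δ (x + suc d) y * A x c E (x + suc d))
      ≡⟨ ∑-cong (downFrom K) (λ d → trans
           (∑-cong (pair K) λ ((x , y) , c , E) → trans (sym (weighted-* (δ (x + suc d) y) _))
             (weighted-cong⁺ λ u 0<u u<7 → trans
               (cong (λ v → δ (x + suc d) y * (w (7 ∸ u) * (δ (suc c) L * δ v N′))) (pair-energy x (suc d) E u (<⇒≤ u<7)))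
               (*-CS.x∙yz≈y∙xz (δ (x + suc d) y) (w (7 ∸ u)) _)))
           (trans (∑-weighted (pair K)
                      (λ u ((x , y) , c , E) → w (7 ∸ u) * (δ (x + suc d) y * (δ (suc c) L * energyTest u (suc d) (x + E)))))
             (weighted-cong λ u → ∑-* (pair K) (w (7 ∸ u)) _))) ⟩
    _ ∎
    where
    A : ℕ → ℕ → ℕ → ℕ → ℕ
    A x c E y = weighted λ u → w (7 ∸ u) * (δ (suc c) L * δ (u * y + ((7 ∸ u) * x + 7 * E)) N′)

  -- Equals `p(n)` if `7n + eD = N` for some `n ≥ 0`, and 0 otherwise: as `n ≤ N < L`, the box
  -- contains all partitions of `n`.
  Q : ℕ → ℕ → ℕ
  Q e D = subsetSum K L (energyTest e D)

  -- The excess `j = m − tri L` satisfies `7j + tD = N`, whence `D + j ≤ N < L`.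
  near-vacuum : ∀ t d → 0 < t → NearVacuum L (suc d) (energyTest t (suc d))
  near-vacuum t d 0<t m with 7 * m + t * suc d ≟ N′
  ... | no ≢ = inj₁ (δ-≢ ≢)
  ... | yes eq with m <? tri L
  ...   | yes m<tri = inj₂ (inj₁ m<tri)
  ...   | no m≮tri = inj₂ (inj₂ (subst (λ v → suc d + v < L + tri L) m≡ (subst (_< L + tri L) (+-assoc (suc d) j (tri L))
                       (+-monoˡ-< (tri L) (≤-<-trans bound N<L)))))
    where
    j = m ∸ tri L
    m≡ : j + tri L ≡ m
    m≡ = m∸n+n≡m (≮⇒≥ m≮tri)
    excess : 7 * j + t * suc d ≡ N
    excess = +-cancelˡ-≡ (7 * tri L) _ _ (trans (lemma (tri L) j (t * suc d)) (trans (cong (λ v → 7 * v + t * suc d) m≡) eq))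
      where lemma : ∀ a j c → 7 * a + (7 * j + c) ≡ 7 * (j + a) + c
            lemma = solve-∀
    bound : suc d + j ≤ N
    bound = ≤-trans (+-mono-≤ (m≤n*m (suc d) t {{>-nonZero 0<t}}) (m≤n*m j 7)) (≤-reflexive (trans (+-comm (t * suc d) (7 * j)) excess))

  -- After `k` rounds the shift `k * D` contributes `7kD`, turning `t` into `e = t + 7k`. After `B`
  -- rounds `7B > N` leaves nothing.
  move-telescoped : ∀ t d → 0 < t → d < K →
    moveSum K L (suc d) (energyTest t (suc d)) ≡ ∑ (downFrom B) λ k → suc d * Q (t + k * 7) (suc d)
  move-telescoped t d 0<t d<K = begin
    moveSum K L D (energyTest t D)
      ≡⟨ telescope L d (energyTest t D) d<K (near-vacuum t d 0<t) B ⟩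
    _ ≡⟨ cong₂ _+_ (∑-cong (downFrom B) λ k → cong (D *_) (∑-cong (subs (downFrom K)) λ (c , E) →
            cong (λ v → δ c L * δ v N′) (lemma k D E t)))
           (moveSum-zero K L D (energyTest t D ∘ (B * D +_)) λ m tri≤m → δ-≢ (>⇒≢ (too-large m tri≤m))) ⟩
    ∑ (downFrom B) (λ k → D * Q (t + k * 7) D) + 0 ≡⟨ +-identityʳ _ ⟩
    _ ∎
    where
    D = suc d
    lemma : ∀ k D E t → 7 * (k * D + E) + t * D ≡ 7 * E + (t + k * 7) * D
    lemma = solve-∀
    N<7B : N < 7 * B
    N<7B = subst (N <_) (trans range (*-comm B 7)) (m≤n⇒m≤1+n (≤-trans N<L (m≤m+n L L)))
    too-large : ∀ m → tri L ≤ m → N′ < 7 * (B * D + m) + t * D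
    too-large m tri≤m = <-≤-trans (subst (N′ <_) (sym (*-distribˡ-+ 7 B (tri L))) (subst (_< 7 * B + 7 * tri L) (+-comm N (7 * tri L))
        (+-monoˡ-< (7 * tri L) N<7B)))
      (≤-trans (*-monoʳ-≤ 7 (+-mono-≤ (m≤m*n B D) tri≤m)) (m≤m+n _ (t * D)))

  -- The residue `t` and the round `k` merge into one index `e`; multiples of 7 enter with weight
  -- `W e = 0`.
  Z₂-divisor-sum : Z₂ K (mayaTest L N) ≡ ∑ (downFrom (suc K)) λ D → ∑ (downFrom (suc K)) λ e → W e * D * Q e D
  Z₂-divisor-sum = begin
    Z₂ K (mayaTest L N)
      ≡⟨ Z₂-moves ⟩
    _ ≡⟨ ∑-cong-All (downFrom-bounded K) by-distance ⟩
    ∑ (downFrom K) (λ d → S (suc d))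
      ≡⟨ +-identityʳ _ ⟨
    ∑ (downFrom K) (λ d → S (suc d)) + 0
      -- The vanishing term `D = 0` is added so that `D` and `e` have the same range and can be
      -- exchanged.
      ≡⟨ cong (∑ (downFrom K) (λ d → S (suc d)) +_)
           (trans (∑-cong (downFrom (suc K)) λ e → cong (_* Q e 0) (*-zeroʳ (W e))) (∑-zero (downFrom (suc K)))) ⟨
    ∑ (downFrom K) (λ d → S (suc d)) + S 0
      ≡⟨ ∑-shift K S ⟨
    ∑ (downFrom (suc K)) S ∎
    where
    S : ℕ → ℕ
    S D = ∑ (downFrom (suc K)) λ e → W e * D * Q e D
    by-distance : ∀ d → d < K → weighted (λ u → w (7 ∸ u) * moveSum K L (suc d) (energyTest u (suc d))) ≡ S (suc d)
    by-distance d d<K = begin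
      _ ≡⟨ weighted-cong⁺ (λ u 0<u u<7 → cong (w (7 ∸ u) *_) (move-telescoped u d 0<u d<K)) ⟩
      weighted (λ u → w (7 ∸ u) * ∑ (downFrom B) λ k → D * Q (u + k * 7) D)
        ≡⟨ weighted-cong (λ u → sym (∑-* (downFrom B) (w (7 ∸ u)) _)) ⟩
      weighted (λ u → ∑ (downFrom B) λ k → w (7 ∸ u) * (D * Q (u + k * 7) D))
        ≡⟨ ∑-weighted (downFrom B) _ ⟨
      ∑ (downFrom B) (λ k → weighted λ u → w (7 ∸ u) * (D * Q (u + k * 7) D))
        ≡⟨ ∑-cong (downFrom B) (λ k → trans (weighted-def _) (∑-cong-All (downFrom-bounded 7) λ u u<7 →
             trans (assoc* (w u) (w (7 ∸ u)) D _) (cong (λ v → v * D * Q (u + k * 7) D) (sym (W-block k u<7))))) ⟩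
      ∑ (downFrom B) (λ k → ∑ (downFrom 7) λ u → W (u + k * 7) * D * Q (u + k * 7) D)
        ≡⟨ ∑-blocks B (λ e → W e * D * Q e D) ⟨
      ∑ (downFrom (B * 7)) (λ e → W e * D * Q e D)
        ≡⟨ cong (λ n → ∑ (downFrom n) (λ e → W e * D * Q e D)) range ⟨
      S D ∎
      where
      D = suc d
      assoc* : ∀ a b c d → a * (b * (c * d)) ≡ a * b * c * d
      assoc* = solve-∀

  Q-sym : ∀ e D → Q e D ≡ Q D e
  Q-sym e D = ∑-cong (subs (downFrom K)) λ (c , E) → cong (λ v → δ c L * δ (7 * E + v) N′) (*-comm e D)

  nonresidue-product : ∀ e D m → 7 * m + e * D ≡ N′ → Nonresidue ((e * D) % 7)
  nonresidue-product e D m eq = subst Nonresidue (begin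
    N % 7                 ≡⟨ %-remove-+ˡ N (m∣m*n (tri L)) ⟨
    (7 * tri L + N) % 7   ≡⟨ cong (_% 7) eq ⟨
    (7 * m + e * D) % 7   ≡⟨ %-remove-+ˡ (e * D) (m∣m*n m) ⟩
    (e * D) % 7           ∎) N-nonresidue

  symmetrised-term : ∀ e D → 7 ∣ (W e * D + W D * e) * Q e D
  symmetrised-term e D with 7 ∣? (W e * D + W D * e)
  ... | yes p = ∣m⇒∣m*n (Q e D) p
  -- Here `e * D` is not a nonresidue, so no background can have total energy `N′` and `Q e D`
  -- vanishes.
  ... | no p  = subst (λ q → 7 ∣ (W e * D + W D * e) * q) (sym Q≡0) (subst (7 ∣_) (sym (*-zeroʳ (W e * D + W D * e))) (7 ∣0))
    where
    Q≡0 : Q e D ≡ 0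
    Q≡0 = trans (∑-cong (subs (downFrom K)) λ (c , E) → trans
      (cong (δ c L *_) (δ-≢ λ eq → p (W-symmetrised e D (nonresidue-product e D E eq)))) (*-zeroʳ (δ c L))) (∑-zero (subs (downFrom K)))

  Z₂-doubled : Z₂ K (mayaTest L N) + Z₂ K (mayaTest L N) ≡
    ∑ (downFrom (suc K)) λ D → ∑ (downFrom (suc K)) λ e → (W e * D + W D * e) * Q e D
  Z₂-doubled = begin
    Z₂ K (mayaTest L N) + Z₂ K (mayaTest L N)
      ≡⟨ cong₂ _+_ Z₂-divisor-sum (trans Z₂-divisor-sum (∑-swap R R (λ D e → W e * D * Q e D))) ⟩
    ∑ R (λ D → ∑ R λ e → W e * D * Q e D) + ∑ R (λ D → ∑ R λ e → W D * e * Q D e)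
      ≡⟨ ∑-+ R (λ D → ∑ R λ e → W e * D * Q e D) (λ D → ∑ R λ e → W D * e * Q D e) ⟨
    ∑ R (λ D → ∑ R (λ e → W e * D * Q e D) + ∑ R (λ e → W D * e * Q D e))
      ≡⟨ ∑-cong R (λ D → trans (sym (∑-+ R (λ e → W e * D * Q e D) (λ e → W D * e * Q D e))) (∑-cong R λ e → trans
           (cong (λ q → W e * D * Q e D + W D * e * q) (Q-sym D e)) (sym (*-distribʳ-+ (Q e D) (W e * D) (W D * e))))) ⟩
    _ ∎
    where R = downFrom (suc K)

  -- Adding the sum to its mirror image under the exchange of `e` and `D` makes each term divisible
  -- by 7; the factor 2 is invertible modulo 7.
  7∣Z₂ : 7 ∣ Z₂ K (mayaTest L N)
  7∣Z₂ = coprime-divisor (from-yes (coprime? 7 2)) (subst (7 ∣_) (trans (sym Z₂-doubled) (double (Z₂ K (mayaTest L N))))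
    (∑-∣ (downFrom (suc K)) _ λ D → ∑-∣ (downFrom (suc K)) _ λ e → symmetrised-term e D))
    where double : ∀ n → n + n ≡ 2 * n
          double = solve-∀

  343∣cφ : 343 ∣ frobeniusCount L N
  343∣cφ = subst (343 ∣_) (sym (trans (frobenius≡maya (≤-<-trans z≤n N<L) N) (proj₂ (expansion K (mayaTest L N)))))
    (∣m∣n⇒∣m+n (subst₂ (λ a b → 343 ∣ a + 7 * b + 49 * Z₂ K (mayaTest L N)) (sym Z₀-vanishes) (sym Z₁-vanishes)
       (*-monoʳ-∣ 49 7∣Z₂)) (m∣m*n (proj₁ (expansion K (mayaTest L N)))))

-- Choice of the cut-off and conclusion

cφ-divisible-by-7³ : ∀ {N} → Nonresidue (N % 7) → Σ ℕ λ m → cφ≡ 7 N m × (7 ^ 3) ∣ m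
cφ-divisible-by-7³ {N} nonresidue = frobeniusCount L N , cφ-count N<L , 343∣cφ {N} {L} {suc (N + N)} nonresidue N<L range
  where
  -- Exceeds `N` and makes `suc (L + L) = 7 (2N + 1)`, so the range of `e` consists of complete
  -- blocks of residues modulo 7.
  L = 3 + 7 * N
  N<L : N < L
  N<L = s≤s (≤-trans (m≤n*m N 7) (m≤n+m (7 * N) 2))
  range : suc (L + L) ≡ suc (N + N) * 7
  range = lemma N
    where lemma : ∀ N → suc (3 + 7 * N + (3 + 7 * N)) ≡ suc (N + N) * 7
          lemma = solve-∀

theorem3p4 : (n : ℕ) →
    (Σ ℕ (λ m → cφ≡ 7 (7 * n + 3) m × (7 ^ 3) ∣ m)) ×
    (Σ ℕ (λ m → cφ≡ 7 (7 * n + 5) m × (7 ^ 3) ∣ m)) ×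
    (Σ ℕ (λ m → cφ≡ 7 (7 * n + 6) m × (7 ^ 3) ∣ m))
theorem3p4 n =
    cφ-divisible-by-7³ (inj₁ (%-remove-+ˡ 3 (m∣m*n n)))
  , cφ-divisible-by-7³ (inj₂ (inj₁ (%-remove-+ˡ 5 (m∣m*n n))))
  , cφ-divisible-by-7³ (inj₂ (inj₂ (%-remove-+ˡ 6 (m∣m*n n))))
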